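{- Let $n\geq 5$ be an integer. Then $\mathcal{D}_3(\vec{C}_{2n+1}\langle n\rangle)$ is connected and has diameter at most $3n+4+\lfloor\frac{2n+1}{3}\rfloor$.
   Context: For $n\ge2$, $\vec{C}_{2n+1}\langle n\rangle$ is the tournament with vertex set $\mathbb{Z}_{2n+1}$ and arcs $(a,a+j)$ for all $a\in\mathbb{Z}_{2n+1}$, $j\in\{1,\dots,n-1\}$, together with arcs $(a,a-n)$ for all $a\in\mathbb{Z}_{2n+1}$. A $k$-coloring of a digraph $D$ is a function $\alpha\colon V(D)\to\{1,\dots,k\}$ such that every color class $\{x:\alpha(x)=i\}$ (possibly empty) induces an acyclic subdigraph. The $k$-dicoloring graph $\mathcal{D}_k(D)$ has the $k$-colorings of $D$ as vertices, two being adjacent iff they differ on exactly one vertex. -}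

module Defs where

open import Data.Nat using (ℕ; zero; suc; _+_; _*_; _∸_; _≤_; _<_)
open import Data.Nat.DivMod using (_%_)
open import Data.Fin using (Fin; toℕ)
open import Data.List using (List; []; _∷_)
open import Data.List.Relation.Unary.All using (All)
open import Data.List.Relation.Unary.Linked using (Linked)
open import Data.List.Relation.Unary.Unique.Propositional using (Unique)
open import Data.Sum using (_⊎_)
open import Data.Product using (Σ; _×_; ∃; ∃-syntax)
open import Relation.Binary.PropositionalEquality using (_≡_; _≢_)
open import Relation.Nullary using (¬_)

record Digraph : Set₁ where
  field
    size : ℕ
    Arc  : Fin size → Fin size → Set
open Digraph public

lastOf : {A : Set} → A → List A → A
lastOf x []       = x
lastOf x (y ∷ ys) = lastOf y ys

CycleIn : (D : Digraph) → (Fin (size D) → Set) → Set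
CycleIn D S = Σ (Fin (size D)) λ x → Σ (List (Fin (size D))) λ xs →
  Unique (x ∷ xs) × All S (x ∷ xs) × Linked (Arc D) (x ∷ xs) × Arc D (lastOf x xs) x

AcyclicOn : (D : Digraph) → (Fin (size D) → Set) → Set
AcyclicOn D S = ¬ CycleIn D S

record Coloring (D : Digraph) (k : ℕ) : Set where
  field
    col     : Fin (size D) → Fin k
    acyclic : (i : Fin k) → AcyclicOn D (λ x → col x ≡ i)
open Coloring public

SameCol : {D : Digraph} {k : ℕ} → Coloring D k → Coloring D k → Set
SameCol {D} α β = (v : Fin (size D)) → col α v ≡ col β v

Adj : {D : Digraph} {k : ℕ} → Coloring D k → Coloring D k → Set
Adj {D} α β = Σ (Fin (size D)) λ v →
  col α v ≢ col β v × ((u : Fin (size D)) → u ≢ v → col α u ≡ col β u)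

data WalkOfLength {D : Digraph} {k : ℕ} : Coloring D k → Coloring D k → ℕ → Set where
  here : {α β : Coloring D k} → SameCol α β → WalkOfLength α β zero
  step : {α γ β : Coloring D k} {ℓ : ℕ} →
         Adj α γ → WalkOfLength γ β ℓ → WalkOfLength α β (suc ℓ)

DicolGraphConnected : Digraph → ℕ → Set
DicolGraphConnected D k = (α β : Coloring D k) → ∃[ ℓ ] WalkOfLength α β ℓ

DicolGraphDiamAtMost : Digraph → ℕ → ℕ → Set
DicolGraphDiamAtMost D k d =
  (α β : Coloring D k) → ∃[ ℓ ] (ℓ ≤ d × WalkOfLength α β ℓ)

-- The tournament C⃗_{2n+1}⟨n⟩ on ℤ_{2n+1} (represented by Fin (2n+1)):
-- arcs (a, a+j) for j ∈ {1,…,n-1} and (a, a-n), i.e. b - a ≡ n+1 (mod 2n+1).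
-- Here d = (b - a) mod (2n+1), computed as (b + (2n+1) - a) % (2n+1).
circDiff : (n : ℕ) → Fin (suc (2 * n)) → Fin (suc (2 * n)) → ℕ
circDiff n a b = (toℕ b + suc (2 * n) ∸ toℕ a) % suc (2 * n)

CArc : (n : ℕ) → Fin (suc (2 * n)) → Fin (suc (2 * n)) → Set
CArc n a b = ((1 ≤ circDiff n a b) × (circDiff n a b ≤ n ∸ 1))
             ⊎ (circDiff n a b ≡ suc n)

Ctour : ℕ → Digraph
Ctour n = record { size = suc (2 * n) ; Arc = CArc n }

{-# OPTIONS --safe #-}

-- Three vertices of ℤₘ, m = 2n + 1, span a directed triangle iff none of their
-- three cyclic gaps is n or at least n + 2.  Hence a colour class is, up to
-- rotation, contained in the window [0, n), or in {0} ∪ [2, n) ∪ {n + 1}, or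
-- equal to {0, n, n + 1}.  If a class c has a vertices, then at most
-- n - a + 2 recolourings turn it into a full window of n vertices.
--
-- With c on [0, n), a Hamming-shortest walk leads to the colouring "c on
-- [0, n), d at n, e on (n, 2n]", and from there 2n recolourings reach the same
-- pattern with d and e exchanged and rotated by any s ≤ n.  The costs of the
-- two purifications add up to at most n + 1 for one of the two roles of d and
-- e, so full windows are joined by 3n + 1 steps.  Finally, some colour c
-- occurs at least m - ⌊m/3⌋ times in the two given colourings together.
module Submission where

open import Defs
open import Data.Nat using (ℕ; _+_; _*_; _≤_)
open import Data.Nat.DivMod using (_/_)
open import Data.Product using (_×_)
open import Data.Bool using (Bool; true; T; _∧_; _∨_)
open import Data.Bool.Properties using (T-∧; T-∨)
open import Data.Empty using (⊥; ⊥-elim)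
open import Data.Fin using (Fin; zero; suc; toℕ; fromℕ<)
import Data.Fin.Properties as Fin
open import Data.List using (List; []; _∷_)
open import Data.List.Relation.Unary.All using (All; []; _∷_)
open import Data.List.Relation.Unary.AllPairs using ([]; _∷_)
open import Data.List.Relation.Unary.Linked using (Linked; [-]; _∷_)
open import Data.Nat using (zero; suc; _∸_; _<_; z≤n; s≤s; _≤?_; _<?_; _≟_; _≤ᵇ_; _<ᵇ_)
open import Data.Nat.DivMod using (_%_; _mod_; m<n⇒m%n≡m; m%n<n; m%n%n≡m%n; [m+n]%n≡m%n; %-distribˡ-+; m≡m%n+[m/n]*n)
open import Data.Nat.Properties
open import Data.Nat.Tactic.RingSolver using (solve-∀)
open import Data.Product using (_,_; proj₁; proj₂; ∃-syntax)
open import Data.Sum using (_⊎_; inj₁; inj₂; [_,_]′)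
open import Data.Vec using (Vec; []; _∷_; lookup; tabulate; zipWith; replicate)
import Data.Vec as Vec
open import Data.Vec.N-ary using (N-ary; _$ⁿ_)
open import Function using (_∘_; Equivalence)
open import Relation.Binary using (tri<; tri≈; tri>)
open import Relation.Binary.PropositionalEquality hiding (_≗_)
open import Relation.Nullary using (¬_; Dec; yes; no; contradiction)
open import Relation.Nullary.Decidable using (toWitness; ¬?; _→-dec_; _⊎-dec_; _×-dec_)

-- Linear arithmetic over ℕ

-- The constant: if the frequent colour has `a` vertices in one colouring and `b` in the other,
-- producing the two windows costs at most (n - a + 2) + (n - b + 2). Since a + b is at least m -
-- ⌊m/3⌋, this is at most 3 + ⌊m/3⌋, and the 3n + 1 steps between full windows give the rest. The
-- obstacle: outside a full window lie n + 1 consecutive vertices, whose two ends form a directed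
-- triangle with any vertex between them (the closing gap is n + 1). So `d` and `e` must both occur
-- there, and a window cannot simply slide along the circle; a pattern with a one-vertex `d`-class
-- leaves the room needed to move it. Legality is not checked step by step: a walk is cut into
-- phases that recolour towards a single colour, and in such a phase only the final class of that
-- colour has to be inspected. Rotations by s ≤ n suffice because walks are reversible: a rotation
-- by more than n becomes one by at most n when the two ends are exchanged.

infixl 6 _:+_
infixl 7 _:*_
infix  4 _:≤_ _:<_ _:≡_
infixr 3 _:⇒_

data Expr (k : ℕ) : Set where
  var  : Fin k → Expr k
  con  : ℕ → Expr k
  _:+_ : Expr k → Expr k → Expr k
  _:*_ : ℕ → Expr k → Expr k

data Atom (k : ℕ) : Set where
  _:≤_ _:≡_ : Expr k → Expr k → Atom k
  falsum    : Atom k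

_:<_ : ∀ {k} → Expr k → Expr k → Atom k
a :< b = con 1 :+ a :≤ b

data Sequent (k : ℕ) : Set where
  goal : Atom k → Sequent k
  _:⇒_ : Atom k → Sequent k → Sequent k

⟦_⟧ : ∀ {k} → Expr k → Vec ℕ k → ℕ
⟦ var i ⟧ ρ  = lookup ρ i
⟦ con c ⟧ ρ  = c
⟦ a :+ b ⟧ ρ = ⟦ a ⟧ ρ + ⟦ b ⟧ ρ
⟦ c :* a ⟧ ρ = c * ⟦ a ⟧ ρ

⟦_⟧ᴬ : ∀ {k} → Atom k → Vec ℕ k → Set
⟦ a :≤ b ⟧ᴬ ρ = ⟦ a ⟧ ρ ≤ ⟦ b ⟧ ρ
⟦ a :≡ b ⟧ᴬ ρ = ⟦ a ⟧ ρ ≡ ⟦ b ⟧ ρ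
⟦ falsum ⟧ᴬ ρ = ⊥

⟦_⟧ˢ : ∀ {k} → Sequent k → Vec ℕ k → Set
⟦ goal a ⟧ˢ ρ = ⟦ a ⟧ᴬ ρ
⟦ a :⇒ s ⟧ˢ ρ = ⟦ a ⟧ᴬ ρ → ⟦ s ⟧ˢ ρ

-- A linear form is the vector of its coefficients, the constant term first.
Form : ℕ → Set
Form k = Vec ℕ (suc k)

dot : ∀ {k} → Vec ℕ k → Vec ℕ k → ℕ
dot []       []       = 0
dot (a ∷ as) (x ∷ xs) = a * x + dot as xs

value : ∀ {k} → Form k → Vec ℕ k → ℕ
value (c ∷ as) ρ = c + dot as ρ

unit : ∀ {k} → Fin k → Vec ℕ k
unit zero    = 1 ∷ replicate _ 0
unit (suc i) = 0 ∷ unit i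

add : ∀ {k} → Vec ℕ k → Vec ℕ k → Vec ℕ k
add = zipWith _+_

form : ∀ {k} → Expr k → Form k
form (var i)  = 0 ∷ unit i
form (con c)  = c ∷ replicate _ 0
form (a :+ b) = add (form a) (form b)
form (c :* a) = Vec.map (c *_) (form a)

dot-zero : ∀ {k} (ρ : Vec ℕ k) → dot (replicate _ 0) ρ ≡ 0
dot-zero []      = refl
dot-zero (_ ∷ ρ) = dot-zero ρ

dot-unit : ∀ {k} (i : Fin k) ρ → dot (unit i) ρ ≡ lookup ρ i
dot-unit zero    (x ∷ ρ) = trans (cong₂ _+_ (+-identityʳ x) (dot-zero ρ)) (+-identityʳ x)
dot-unit (suc i) (x ∷ ρ) = dot-unit i ρ

dot-add : ∀ {k} (as bs ρ : Vec ℕ k) → dot (add as bs) ρ ≡ dot as ρ + dot bs ρ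
dot-add []       []       []      = refl
dot-add (a ∷ as) (b ∷ bs) (x ∷ ρ) =
  trans (cong ((a + b) * x +_) (dot-add as bs ρ)) (rearrange a b x (dot as ρ) (dot bs ρ))
  where
  rearrange : ∀ a b x u v → (a + b) * x + (u + v) ≡ a * x + u + (b * x + v)
  rearrange = solve-∀

dot-scale : ∀ {k} c (as ρ : Vec ℕ k) → dot (Vec.map (c *_) as) ρ ≡ c * dot as ρ
dot-scale c []       []      = sym (*-zeroʳ c)
dot-scale c (a ∷ as) (x ∷ ρ) =
  trans (cong (c * a * x +_) (dot-scale c as ρ)) (rearrange c a x (dot as ρ))
  where
  rearrange : ∀ c a x u → c * a * x + c * u ≡ c * (a * x + u)
  rearrange = solve-∀

value-add : ∀ {k} (f g : Form k) ρ → value (add f g) ρ ≡ value f ρ + value g ρ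
value-add (c ∷ as) (d ∷ bs) ρ =
  trans (cong (c + d +_) (dot-add as bs ρ)) (+-interchange c d (dot as ρ) (dot bs ρ))
  where
  +-interchange : ∀ a b c d → a + b + (c + d) ≡ a + c + (b + d)
  +-interchange = solve-∀

value-form : ∀ {k} (a : Expr k) ρ → value (form a) ρ ≡ ⟦ a ⟧ ρ
value-form (var i)  ρ = dot-unit i ρ
value-form (con c)  ρ = trans (cong (c +_) (dot-zero ρ)) (+-identityʳ c)
value-form (a :+ b) ρ = trans (value-add (form a) (form b) ρ) (cong₂ _+_ (value-form a ρ) (value-form b ρ))
value-form (c :* a) ρ with form a | value-form a ρ
... | d ∷ as | eq = trans (cong (c * d +_) (dot-scale c as ρ)) (trans (sym (*-distribˡ-+ c d (dot as ρ))) (cong (c *_) eq))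

-- The two sides are kept apart, so coefficients stay natural numbers and adding inequalities needs
-- no subtraction.
Ineq : ℕ → Set
Ineq k = Form k × Form k

Holds : ∀ {k} → Vec ℕ k → Ineq k → Set
Holds ρ (l , r) = value l ρ ≤ value r ρ

_⊞_ : ∀ {k} → Ineq k → Ineq k → Ineq k
(l , r) ⊞ (l′ , r′) = add l l′ , add r r′

⊞-holds : ∀ {k} {ρ : Vec ℕ k} {a b} → Holds ρ a → Holds ρ b → Holds ρ (a ⊞ b)
⊞-holds {ρ = ρ} {l , r} {l′ , r′} h h′ =
  subst₂ _≤_ (sym (value-add l l′ ρ)) (sym (value-add r r′ ρ)) (+-mono-≤ h h′)

dominates : ∀ {k} → Vec ℕ k → Vec ℕ k → Bool
dominates []       []       = true
dominates (a ∷ as) (b ∷ bs) = (b ≤ᵇ a) ∧ dominates as bs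

-- The left form exceeds the right one coefficient by coefficient, strictly in the constant; as
-- variables are natural numbers, no valuation satisfies such an inequality.
absurd : ∀ {k} → Ineq k → Bool
absurd ((c ∷ as) , (d ∷ bs)) = (d <ᵇ c) ∧ dominates as bs

dominates-sound : ∀ {k} (as bs : Vec ℕ k) → T (dominates as bs) → ∀ ρ → dot bs ρ ≤ dot as ρ
dominates-sound []       []       _ []      = z≤n
dominates-sound (a ∷ as) (b ∷ bs) t (x ∷ ρ) with Equivalence.to (T-∧ {b ≤ᵇ a}) t
... | t₁ , t₂ = +-mono-≤ (*-monoˡ-≤ x (≤ᵇ⇒≤ b a t₁)) (dominates-sound as bs t₂ ρ)

absurd-sound : ∀ {k} (a : Ineq k) {ρ} → T (absurd a) → ¬ Holds ρ a
absurd-sound ((c ∷ as) , (d ∷ bs)) {ρ} t h with Equivalence.to (T-∧ {d <ᵇ c}) t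
... | t₁ , t₂ = <⇒≱ (+-mono-<-≤ (<ᵇ⇒< d c t₁) (dominates-sound as bs t₂ ρ)) h

-- Searches for a Farkas certificate: a contradictory sum of the
-- accumulator and of the hypotheses with multiplicities at most 2.
refutable : ∀ {k} → List (Ineq k) → Ineq k → Bool
refutable []       acc = absurd acc
refutable (h ∷ hs) acc = refutable hs acc ∨ refutable hs (h ⊞ acc) ∨ refutable hs (h ⊞ (h ⊞ acc))

refutable-sound : ∀ {k} {ρ : Vec ℕ k} hs acc → T (refutable hs acc) → All (Holds ρ) hs → ¬ Holds ρ acc
refutable-sound []       acc t []         a = absurd-sound acc t a
refutable-sound {ρ = ρ} (h ∷ hs) acc t (p ∷ ps) a with Equivalence.to (T-∨ {refutable hs acc}) t
... | inj₁ t₀ = refutable-sound hs acc t₀ ps a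
... | inj₂ t′ with Equivalence.to (T-∨ {refutable hs (h ⊞ acc)}) t′
...   | inj₁ t₁ = refutable-sound hs _ t₁ ps (⊞-holds {ρ = ρ} {h} {acc} p a)
...   | inj₂ t₂ = refutable-sound hs _ t₂ ps
                    (⊞-holds {ρ = ρ} {h} {h ⊞ acc} p (⊞-holds {ρ = ρ} {h} {acc} p a))

ineq : ∀ {k} → Expr k → Expr k → Ineq k
ineq a b = form a , form b

holds : ∀ {k} {ρ : Vec ℕ k} (a b : Expr k) → ⟦ a ⟧ ρ ≤ ⟦ b ⟧ ρ → Holds ρ (ineq a b)
holds {ρ = ρ} a b = subst₂ _≤_ (sym (value-form a ρ)) (sym (value-form b ρ))

assume : ∀ {k} → Atom k → List (Ineq k) → List (Ineq k)
assume (a :≤ b) hs = ineq a b ∷ hs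
assume (a :≡ b) hs = ineq a b ∷ ineq b a ∷ hs
assume falsum   hs = hs

assume-sound : ∀ {k} {ρ : Vec ℕ k} (a : Atom k) {hs} → ⟦ a ⟧ᴬ ρ → All (Holds ρ) hs → All (Holds ρ) (assume a hs)
assume-sound (a :≤ b) h hs = holds a b h ∷ hs
assume-sound (a :≡ b) h hs = holds a b (≤-reflexive h) ∷ holds b a (≤-reflexive (sym h)) ∷ hs
assume-sound falsum   h hs = hs

proves : ∀ {k} → List (Ineq k) → Atom k → Bool
-- The negated goal `b < a` is the initial accumulator, so it enters a certificate exactly once.
proves hs (a :≤ b) = refutable hs (ineq (con 1 :+ b) a)
proves hs (a :≡ b) = proves hs (a :≤ b) ∧ proves hs (b :≤ a)
proves hs falsum   = refutable hs (ineq (con 0) (con 0))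

proves-≤ : ∀ {k} {ρ : Vec ℕ k} hs (a b : Expr k) → T (proves hs (a :≤ b)) → All (Holds ρ) hs → ⟦ a ⟧ ρ ≤ ⟦ b ⟧ ρ
proves-≤ hs a b t ps = ≮⇒≥ λ b<a → refutable-sound hs _ t ps (holds (con 1 :+ b) a b<a)

proves-sound : ∀ {k} {ρ : Vec ℕ k} hs (a : Atom k) → T (proves hs a) → All (Holds ρ) hs → ⟦ a ⟧ᴬ ρ
proves-sound hs (a :≤ b) t ps = proves-≤ hs a b t ps
proves-sound hs (a :≡ b) t ps with Equivalence.to (T-∧ {proves hs (a :≤ b)}) t
... | t₁ , t₂ = ≤-antisym (proves-≤ hs a b t₁ ps) (proves-≤ hs b a t₂ ps)
proves-sound {ρ = ρ} hs falsum t ps = refutable-sound {ρ = ρ} hs _ t ps ≤-refl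

valid : ∀ {k} → List (Ineq k) → Sequent k → Bool
valid hs (goal a) = proves hs a
valid hs (a :⇒ s) = valid (assume a hs) s

valid-sound : ∀ {k} {ρ : Vec ℕ k} hs (s : Sequent k) → T (valid hs s) → All (Holds ρ) hs → ⟦ s ⟧ˢ ρ
valid-sound hs (goal a) t ps   = proves-sound hs a t ps
valid-sound hs (a :⇒ s) t ps h = valid-sound (assume a hs) s t (assume-sound a h ps)

Forall : ∀ k → (Vec ℕ k → Set) → Set
Forall zero    P = P []
Forall (suc k) P = ∀ x → Forall k (P ∘ (x ∷_))

forall-intro : ∀ k {P : Vec ℕ k → Set} → (∀ ρ → P ρ) → Forall k P
forall-intro zero    p = p []
forall-intro (suc k) p = λ x → forall-intro k (p ∘ (x ∷_))

-- Proof by reflection: for a sequent with a certificate, `T` evaluates to the unit type, so the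
-- implicit argument is filled by running the search.
linear : ∀ k (s : N-ary k (Expr k) (Sequent k)) → let s′ = s $ⁿ tabulate var in
         {_ : T (valid [] s′)} → Forall k ⟦ s′ ⟧ˢ
linear k s {t} = forall-intro k λ ρ → valid-sound [] (s $ⁿ tabulate var) t []

:m : ∀ {k} → Expr k → Expr k
:m n = con 1 :+ 2 :* n

-- Finite sums

sum : ℕ → (ℕ → ℕ) → ℕ
sum zero    φ = 0
sum (suc k) φ = sum k φ + φ k

sum-mono : ∀ k {φ ψ} → (∀ t → t < k → φ t ≤ ψ t) → sum k φ ≤ sum k ψ
sum-mono zero    h = z≤n
sum-mono (suc k) h = +-mono-≤ (sum-mono k λ t → h t ∘ m<n⇒m<1+n) (h k ≤-refl)

sum-+ : ∀ k φ ψ → sum k (λ t → φ t + ψ t) ≡ sum k φ + sum k ψ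
sum-+ zero    φ ψ = refl
sum-+ (suc k) φ ψ = trans (cong (_+ (φ k + ψ k)) (sum-+ k φ ψ)) (interchange (sum k φ) (sum k ψ) (φ k) (ψ k))
  where
  interchange : ∀ a b c d → a + b + (c + d) ≡ a + c + (b + d)
  interchange = solve-∀

sum-cong : ∀ k {φ ψ} → (∀ t → t < k → φ t ≡ ψ t) → sum k φ ≡ sum k ψ
sum-cong zero    h = refl
sum-cong (suc k) h = cong₂ _+_ (sum-cong k λ t → h t ∘ m<n⇒m<1+n) (h k ≤-refl)

sum-split : ∀ k l φ → sum (k + l) φ ≡ sum k φ + sum l (φ ∘ (k +_))
sum-split k zero    φ rewrite +-identityʳ k = sym (+-identityʳ _)
sum-split k (suc l) φ rewrite +-suc k l =
  trans (cong (_+ φ (k + l)) (sum-split k l φ)) (+-assoc (sum k φ) _ _)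

sum-zero : ∀ k {φ} → (∀ t → t < k → φ t ≡ 0) → sum k φ ≡ 0
sum-zero zero    h = refl
sum-zero (suc k) h = cong₂ _+_ (sum-zero k λ t → h t ∘ m<n⇒m<1+n) (h k ≤-refl)

sum-one : ∀ k → sum k (λ _ → 1) ≡ k
sum-one zero    = refl
sum-one (suc k) = trans (cong (_+ 1) (sum-one k)) (+-comm k 1)

-- The interval may reach beyond `k`, so the induction on `k` leaves `l` free: if the last index
-- lies inside, what precedes it is supported on `[a, k)`, of length `d`.
sum-support : ∀ k a l {φ} → (∀ t → t < k → φ t ≤ 1) →
              (∀ t → t < k → t < a ⊎ a + l ≤ t → φ t ≡ 0) → sum k φ ≤ l
sum-support zero    a l ≤1 out = z≤n
sum-support (suc k) a l {φ} ≤1 out with k <? a | k <? a + l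
... | yes k<a | _ = ≤-trans (≤-reflexive (sum-zero (suc k)
        λ t t<1+k → out t t<1+k (inj₁ (≤-<-trans (m<1+n⇒m≤n t<1+k) k<a)))) z≤n
... | no  _   | no k≮b = subst (_≤ l) (sym (trans (cong (sum k φ +_) (out k ≤-refl (inj₂ (≮⇒≥ k≮b)))) (+-identityʳ _)))
        (sum-support k a l (λ t → ≤1 t ∘ m<n⇒m<1+n) (λ t → out t ∘ m<n⇒m<1+n))
... | no  k≮a | yes k<b with m≤n⇒∃[o]m+o≡n (≮⇒≥ k≮a)
...   | d , a+d≡k = ≤-trans (+-mono-≤ (sum-support k a d (λ t → ≤1 t ∘ m<n⇒m<1+n) out′) (≤1 k ≤-refl))
                      (linear 4 (λ a d k l → a :+ d :≡ k :⇒ k :< a :+ l :⇒ goal (d :+ con 1 :≤ l)) a d k l a+d≡k k<b)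
  where
  out′ : ∀ t → t < k → t < a ⊎ a + d ≤ t → φ t ≡ 0
  out′ t t<k (inj₁ t<a)   = out t (m<n⇒m<1+n t<k) (inj₁ t<a)
  out′ t t<k (inj₂ a+d≤t) = contradiction (subst (_≤ t) a+d≡k a+d≤t) (<⇒≱ t<k)

gap⇒< : ∀ {i p j} → i + p ≡ j → 1 ≤ p → i < j
gap⇒< {i} {p} {j} = linear 3 (λ i p j → i :+ p :≡ j :⇒ con 1 :≤ p :⇒ goal (i :< j)) i p j

≤⇒∃+ : ∀ {a b} → a ≤ b → ∃[ d ] d + a ≡ b
≤⇒∃+ {a} a≤b with m≤n⇒∃[o]m+o≡n a≤b
... | d , eq = d , trans (+-comm d a) eq

-- Colours, indicator functions and painting an interval

Colour : Set
Colour = Fin 3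

_≟ᶜ_ : (x y : Colour) → Dec (x ≡ y)
_≟ᶜ_ = Fin._≟_

ind : ∀ {A : Set} → Dec A → ℕ
ind (yes _) = 1
ind (no  _) = 0

ind≤1 : ∀ {A : Set} (d : Dec A) → ind d ≤ 1
ind≤1 (yes _) = ≤-refl
ind≤1 (no  _) = z≤n

ind-yes : ∀ {A : Set} (d : Dec A) → A → ind d ≡ 1
ind-yes (yes _) _ = refl
ind-yes (no ¬a) a = contradiction a ¬a

ind-no : ∀ {A : Set} (d : Dec A) → ¬ A → ind d ≡ 0
ind-no (yes a) ¬a = contradiction a ¬a
ind-no (no _)  _  = refl

co : ∀ {A : Set} → Dec A → ℕ
co (yes _) = 0
co (no  _) = 1

differ : Colour → Colour → ℕ
differ x y = co (x ≟ᶜ y)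

differ-≡ : ∀ {x y} → x ≡ y → differ x y ≡ 0
differ-≡ {x} {y} x≡y with x ≟ᶜ y
... | yes _  = refl
... | no x≢y = contradiction x≡y x≢y

differ≤1 : ∀ x y → differ x y ≤ 1
differ≤1 x y with x ≟ᶜ y
... | yes _ = z≤n
... | no  _ = ≤-refl

opaque
  -- The interval is not read modulo `m`; a class that runs through 0 is assembled from separate
  -- pieces.
  paint : (ℕ → Colour) → ℕ → ℕ → Colour → ℕ → Colour
  paint f a l x t with a ≤? t | t <? a + l
  ... | yes _ | yes _ = x
  ... | _     | _     = f t

module _ {f : ℕ → Colour} {a l : ℕ} {x : Colour} where

  opaque
    unfolding paint

    paint-in : ∀ {t} → a ≤ t → t < a + l → paint f a l x t ≡ x
    paint-in {t} a≤t t<b with a ≤? t | t <? a + l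
    ... | yes _  | yes _  = refl
    ... | yes _  | no t≮b = contradiction t<b t≮b
    ... | no a≰t | _      = contradiction a≤t a≰t

    paint-below : ∀ {t} → t < a → paint f a l x t ≡ f t
    paint-below {t} t<a with a ≤? t | t <? a + l
    ... | yes a≤t | yes _ = contradiction a≤t (<⇒≱ t<a)
    ... | yes _   | no _  = refl
    ... | no _    | _     = refl

    paint-above : ∀ {t} → a + l ≤ t → paint f a l x t ≡ f t
    paint-above {t} b≤t with a ≤? t | t <? a + l
    ... | yes _ | yes t<b = contradiction b≤t (<⇒≱ t<b)
    ... | yes _ | no _    = refl
    ... | no _  | _       = refl

    paint-inv : ∀ {t y} → paint f a l x t ≡ y →
                (x ≡ y × a ≤ t × t < a + l) ⊎ (f t ≡ y × (t < a ⊎ a + l ≤ t))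
    paint-inv {t} eq with a ≤? t | t <? a + l
    ... | yes a≤t | yes t<b = inj₁ (eq , a≤t , t<b)
    ... | yes _   | no t≮b  = inj₂ (eq , inj₂ (≮⇒≥ t≮b))
    ... | no a≰t  | _       = inj₂ (eq , inj₁ (≰⇒> a≰t))

    paint-old : ∀ {t y} → x ≢ y → paint f a l x t ≡ y → f t ≡ y × (t < a ⊎ a + l ≤ t)
    paint-old x≢y eq with paint-inv eq
    ... | inj₁ (x≡y , _) = contradiction x≡y x≢y
    ... | inj₂ old       = old

    paint-or : ∀ t → paint f a l x t ≡ f t ⊎ paint f a l x t ≡ x
    paint-or t with a ≤? t | t <? a + l
    ... | yes _ | yes _ = inj₂ refl
    ... | yes _ | no  _ = inj₁ refl
    ... | no  _ | _     = inj₁ refl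

-- Triangle-free classes on the circle and walks between good colourings

module Circle (n : ℕ) where

  m : ℕ
  m = suc (2 * n)

  -- For a gap `g` from 1 to 2n, forward means that the arc goes from `a` to `a + g`; the value n +
  -- 1 is the arc to `a - n`. The reflection of `g` to `m - g` exchanges the two kinds.
  Backward Forward : ℕ → Set
  Backward g = g ≡ n ⊎ suc (suc n) ≤ g
  Forward  g = suc g ≤ n ⊎ g ≡ suc n

  forward⇒¬backward : ∀ {g} → Forward g → ¬ Backward g
  forward⇒¬backward (inj₁ g<n)  (inj₁ refl) = <-irrefl refl g<n
  forward⇒¬backward {g} (inj₁ g<n)  (inj₂ n+2≤g) =
    linear 2 (λ n g → g :< n :⇒ con 2 :+ n :≤ g :⇒ goal falsum) n g g<n n+2≤g
  forward⇒¬backward (inj₂ refl) (inj₁ 1+n≡n) = 1+n≢n 1+n≡n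
  forward⇒¬backward (inj₂ refl) (inj₂ 2+n≤1+n) = 1+n≰n 2+n≤1+n

  backward⊎forward : ∀ g → Backward g ⊎ Forward g
  backward⊎forward g with g ≟ n | g <? n | g ≟ suc n
  ... | yes g≡n | _ | _ = inj₁ (inj₁ g≡n)
  ... | no _ | yes g<n | _ = inj₂ (inj₁ g<n)
  ... | no _ | no _ | yes g≡1+n = inj₂ (inj₂ g≡1+n)
  ... | no g≢n | no g≮n | no g≢1+n = inj₁ (inj₂ (≤∧≢⇒< (≤∧≢⇒< (≮⇒≥ g≮n) (g≢n ∘ sym)) (g≢1+n ∘ sym)))

  -- Three points of ℤₘ whose consecutive gaps are p, q, r span a directed
  -- triangle iff all three gaps are forward.
  TriFree : (ℕ → Set) → Set
  TriFree P = ∀ {i j k} p q r → i + p ≡ j → j + q ≡ k → k + r ≡ i + m →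
              1 ≤ p → 1 ≤ q → k < m → P i → P j → P k →
              Backward p ⊎ Backward q ⊎ Backward r

  Good : (ℕ → Colour) → Set
  Good f = ∀ x → TriFree (λ t → f t ≡ x)

  triFree-⊆ : ∀ {P Q : ℕ → Set} → (∀ t → t < m → P t → Q t) → TriFree Q → TriFree P
  triFree-⊆ {P} {Q} P⊆Q tri {i} {j} {k} p q r ip jq kr 1≤p 1≤q k<m Pi Pj Pk =
    tri p q r ip jq kr 1≤p 1≤q k<m (P⊆Q i i<m Pi) (P⊆Q j j<m Pj) (P⊆Q k k<m Pk)
    where
    j<m : j < m
    j<m = ≤-<-trans (≤-trans (m≤m+n j q) (≤-reflexive jq)) k<m
    i<m : i < m
    i<m = ≤-<-trans (≤-trans (m≤m+n i p) (≤-reflexive ip)) j<m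

  -- The outermost points are less than `n` apart, so the gap `r` that closes the cycle is at least
  -- n + 2.
  triFree-arc : ∀ {P : ℕ → Set} a → (∀ t → t < m → P t → a ≤ t × t < a + n) → TriFree P
  triFree-arc a arc = triFree-⊆ arc λ {i} {j} {k} p q r ip jq kr _ _ _ (a≤i , _) _ (_ , k<b) →
    inj₂ (inj₂ (inj₂ (linear 5 (λ n a i k r → k :+ r :≡ i :+ :m n :⇒ a :≤ i :⇒ k :< a :+ n :⇒ goal (con 2 :+ n :≤ r))
      n a i k r kr a≤i k<b)))

  -- The class lies in `n` cyclically consecutive vertices again, but possibly through 0, so it is
  -- described by the n + 1 missing vertices from `a` to `a + n`. Whichever gap jumps over them is
  -- at least n + 2.
  triFree-coarc : ∀ {P : ℕ → Set} a → a ≤ n → (∀ t → t < m → P t → t < a ⊎ a + suc n ≤ t) → TriFree P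
  triFree-coarc a a≤n coarc = triFree-⊆ coarc tri
    where
    tri : TriFree (λ t → t < a ⊎ a + suc n ≤ t)
    tri {i} {j} {k} p q r ip jq kr _ _ k<m (inj₂ b≤i) _ _ =
      inj₂ (inj₂ (inj₂ (linear 5 (λ n a i k r → k :+ r :≡ i :+ :m n :⇒ k :< :m n :⇒ a :+ (con 1 :+ n) :≤ i :⇒ goal (con 2 :+ n :≤ r))
        n a i k r kr k<m b≤i)))
    tri {i} {j} {k} p q r ip jq kr _ _ k<m _ _ (inj₁ k<a) =
      inj₂ (inj₂ (inj₂ (linear 5 (λ n a i k r → k :+ r :≡ i :+ :m n :⇒ a :≤ n :⇒ k :< a :⇒ goal (con 2 :+ n :≤ r))
        n a i k r kr a≤n k<a)))
    tri {i} {j} {k} p q r ip jq kr _ _ k<m (inj₁ i<a) (inj₂ b≤j) _ =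
      inj₁ (inj₂ (linear 5 (λ n a i j p → i :+ p :≡ j :⇒ i :< a :⇒ a :+ (con 1 :+ n) :≤ j :⇒ goal (con 2 :+ n :≤ p))
        n a i j p ip i<a b≤j))
    tri {i} {j} {k} p q r ip jq kr _ _ k<m _ (inj₁ j<a) (inj₂ b≤k) =
      inj₂ (inj₁ (inj₂ (linear 5 (λ n a i j p → i :+ p :≡ j :⇒ i :< a :⇒ a :+ (con 1 :+ n) :≤ j :⇒ goal (con 2 :+ n :≤ p))
        n a j k q jq j<a b≤k)))

  triFree-pair : ∀ {P : ℕ → Set} u v → (∀ t → t < m → P t → t ≡ u ⊎ t ≡ v) → TriFree P
  triFree-pair u v pair = triFree-⊆ pair λ {i} {j} {k} p q r ip jq kr 1≤p 1≤q _ i∈ j∈ k∈ →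
    ⊥-elim (three (gap⇒< ip 1≤p) (gap⇒< jq 1≤q) i∈ j∈ k∈)
    where
    three : ∀ {i j k} → i < j → j < k → i ≡ u ⊎ i ≡ v → j ≡ u ⊎ j ≡ v → k ≡ u ⊎ k ≡ v → ⊥
    three i<j j<k (inj₁ refl) (inj₁ refl) _           = <-irrefl refl i<j
    three i<j j<k (inj₂ refl) (inj₂ refl) _           = <-irrefl refl i<j
    three i<j j<k _           (inj₁ refl) (inj₁ refl) = <-irrefl refl j<k
    three i<j j<k _           (inj₂ refl) (inj₂ refl) = <-irrefl refl j<k
    three i<j j<k (inj₁ refl) (inj₂ refl) (inj₁ refl) = <-asym i<j j<k
    three i<j j<k (inj₂ refl) (inj₁ refl) (inj₂ refl) = <-asym i<j j<k

  infix 4 _≗_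
  _≗_ : (f g : ℕ → Colour) → Set
  f ≗ g = ∀ t → t < m → f t ≡ g t

  good-≗ : ∀ {f g} → f ≗ g → Good f → Good g
  good-≗ f≗g good x = triFree-⊆ (λ t t<m → trans (f≗g t t<m)) (good x)

  -- Colourings are functions on ℕ of which only the values below `m` count, so that rotation is
  -- plain index arithmetic; `done` therefore asks for agreement below `m` only. Each step carries
  -- the goodness of the colouring it enters.
  data Walk (f g : ℕ → Colour) : ℕ → Set where
    done : f ≗ g → Walk f g 0
    step : ∀ {h k} v → v < m → f v ≢ h v → (∀ t → t < m → t ≢ v → f t ≡ h t) →
           Good h → Walk h g k → Walk f g (suc k)

  walk-good : ∀ {f g k} → Good f → Walk f g k → Good g
  walk-good good (done f≗g)         = good-≗ f≗g good
  walk-good _    (step _ _ _ _ good w) = walk-good good w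

  infixr 5 _++_
  _++_ : ∀ {f g h k l} → Walk f g k → Walk g h l → Walk f h (k + l)
  done f≗g ++ done g≗h = done λ t t<m → trans (f≗g t t<m) (g≗h t t<m)
  done f≗g ++ step v v<m gv≢ same good w =
    step v v<m (gv≢ ∘ trans (sym (f≗g v v<m))) (λ t t<m t≢v → trans (f≗g t t<m) (same t t<m t≢v)) good w
  step v v<m fv≢ same good w ++ w′ = step v v<m fv≢ same good (w ++ w′)

  reverse : ∀ {f g k} → Good f → Walk f g k → Walk g f k
  reverse _ (done f≗g) = done λ t t<m → sym (f≗g t t<m)
  reverse {k = suc k} good (step v v<m fv≢ same good′ w) = subst (Walk _ _) (+-comm k 1)
    (reverse good′ w ++ step v v<m (fv≢ ∘ sym) (λ t t<m t≢v → sym (same t t<m t≢v)) good (done λ _ _ → refl))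

  distance : (f g : ℕ → Colour) → ℕ
  distance f g = sum m (λ t → differ (f t) (g t))

  -- If all changes are to one colour x, every intermediate colouring has its
  -- x-class inside that of g and its other classes inside those of f.
  recolour : ∀ {f} g x → Good f → (∀ t → t < m → g t ≡ f t ⊎ g t ≡ x) →
             TriFree (λ t → g t ≡ x) → Walk f g (distance f g)
  recolour {f} g x good change tri =
    walkTo m ≤-refl ++₀ λ t t<m → mix-below t<m
    where
    -- The vertices are treated in increasing order: `mix k` shows `g` below `k` and still `f` from
    -- `k` on.
    mix : ℕ → ℕ → Colour
    mix k = paint′ k
      where
      paint′ : ℕ → ℕ → Colour
      paint′ k t with t <? k
      ... | yes _ = g t
      ... | no  _ = f t
    mix-below : ∀ {k t} → t < k → mix k t ≡ g t
    mix-below {k} {t} t<k with t <? k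
    ... | yes _  = refl
    ... | no t≮k = contradiction t<k t≮k
    mix-above : ∀ {k t} → k ≤ t → mix k t ≡ f t
    mix-above {k} {t} k≤t with t <? k
    ... | yes t<k = contradiction k≤t (<⇒≱ t<k)
    ... | no _    = refl
    mix-x : ∀ k t → t < m → mix k t ≡ x → g t ≡ x
    mix-x k t t<m eq with t <? k | change t t<m
    ... | yes _ | _          = eq
    ... | no _  | inj₁ gt≡ft = trans gt≡ft eq
    ... | no _  | inj₂ gt≡x  = gt≡x
    mix-y : ∀ k {y} → y ≢ x → ∀ t → t < m → mix k t ≡ y → f t ≡ y
    mix-y k y≢x t t<m eq with t <? k | change t t<m
    ... | yes _ | inj₁ gt≡ft = trans (sym gt≡ft) eq
    ... | yes _ | inj₂ gt≡x  = contradiction (trans (sym eq) gt≡x) y≢x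
    ... | no _  | _          = eq
    mix-good : ∀ k → Good (mix k)
    mix-good k y with y ≟ᶜ x
    ... | yes refl = triFree-⊆ (mix-x k) tri
    ... | no y≢x   = triFree-⊆ (mix-y k y≢x) (good y)
    mix-same : ∀ k t → t ≢ k → mix k t ≡ mix (suc k) t
    mix-same k t t≢k with <-cmp t k
    ... | tri< t<k _ _ = trans (mix-below t<k) (sym (mix-below (m<n⇒m<1+n t<k)))
    ... | tri≈ _ t≡k _ = contradiction t≡k t≢k
    ... | tri> _ _ k<t = trans (mix-above (<⇒≤ k<t)) (sym (mix-above k<t))
    walkStep : ∀ k → k < m → Walk (mix k) (mix (suc k)) (differ (f k) (g k))
    walkStep k k<m with f k ≟ᶜ g k
    -- A vertex that already has its final colour takes no step, which makes the length equal to the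
    -- Hamming distance.
    ... | yes fk≡gk = done λ t t<m → same t
      where
      same : ∀ t → mix k t ≡ mix (suc k) t
      same t with t ≟ k
      ... | yes refl = trans (mix-above ≤-refl) (trans fk≡gk (sym (mix-below ≤-refl)))
      ... | no t≢k   = mix-same k t t≢k
    ... | no fk≢gk = step k k<m (λ eq → fk≢gk (trans (sym (mix-above ≤-refl)) (trans eq (mix-below ≤-refl))))
                       (λ t _ → mix-same k t) (mix-good (suc k)) (done λ _ _ → refl)
    walkTo : ∀ k → k ≤ m → Walk f (mix k) (sum k (λ t → differ (f t) (g t)))
    walkTo zero    _   = done λ t _ → sym (mix-above z≤n)
    walkTo (suc k) k<m = walkTo k (<⇒≤ k<m) ++ walkStep k k<m
    _++₀_ : ∀ {h k} → Walk f h k → h ≗ g → Walk f g k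
    _++₀_ {k = k} w h≗g = subst (Walk _ _) (+-identityʳ k) (w ++ done h≗g)

  Reach : (f g : ℕ → Colour) → ℕ → Set
  Reach f g b = ∃[ k ] k ≤ b × Walk f g k

  paintWalk : ∀ {f} a l x → Good f → TriFree (λ t → paint f a l x t ≡ x) → Reach f (paint f a l x) l
  paintWalk {f} a l x good tri =
    _ , sum-support m a l (λ t _ → differ≤1 (f t) _) outside , recolour _ x good (λ t _ → paint-or t) tri
    where
    outside : ∀ t → t < m → t < a ⊎ a + l ≤ t → differ (f t) (paint f a l x t) ≡ 0
    outside t _ (inj₁ t<a) = differ-≡ (sym (paint-below t<a))
    outside t _ (inj₂ b≤t) = differ-≡ (sym (paint-above b≤t))

-- Rotation invariance

module View (n : ℕ) where
  open Circle n

  view : ℕ → (ℕ → Colour) → ℕ → Colour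
  view p f t = f ((p + t) % m)

  -- Turns a remainder modulo `m` into a linear equation or inequality, with one case for each side
  -- of the wrap.
  data Shifted (p t : ℕ) : ℕ → Set where
    straight : p + t < m → Shifted p t (p + t)
    wrapped  : ∀ u → u + m ≡ p + t → Shifted p t u

  shifted : ∀ {p t} → p < m → t < m → Shifted p t ((p + t) % m)
  shifted {p} {t} p<m t<m with p + t <? m
  ... | yes p+t<m = subst (Shifted p t) (sym (m<n⇒m%n≡m p+t<m)) (straight p+t<m)
  ... | no  p+t≮m with ≤⇒∃+ (≮⇒≥ p+t≮m)
  ...   | u , u+m≡p+t = subst (Shifted p t) (sym eq) (wrapped u u+m≡p+t)
    where
    u<m : u < m
    u<m = linear 4 (λ m p t u → u :+ m :≡ p :+ t :⇒ p :< m :⇒ t :< m :⇒ goal (u :< m)) m p t u u+m≡p+t p<m t<m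
    eq : (p + t) % m ≡ u
    eq = trans (cong (_% m) (sym u+m≡p+t)) (trans ([m+n]%n≡m%n u m) (m<n⇒m%n≡m u<m))

  %-absorb : ∀ a b → (a + b % m) % m ≡ (a + b) % m
  %-absorb a b = begin
    (a + b % m) % m             ≡⟨ %-distribˡ-+ a (b % m) m ⟩
    (a % m + b % m % m) % m     ≡⟨ cong (λ c → (a % m + c) % m) (m%n%n≡m%n b m) ⟩
    (a % m + b % m) % m         ≡⟨ %-distribˡ-+ a b m ⟨
    (a + b) % m                 ∎
    where open ≡-Reasoning

  view-view : ∀ p q f → view p (view q f) ≗ view ((q + p) % m) f
  view-view p q f t _ = cong f (begin
    (q + (p + t) % m) % m   ≡⟨ %-absorb q (p + t) ⟩
    (q + (p + t)) % m       ≡⟨ cong (_% m) (trans (sym (+-assoc q p t)) (+-comm (q + p) t)) ⟩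
    (t + (q + p)) % m       ≡⟨ %-absorb t (q + p) ⟨
    (t + (q + p) % m) % m   ≡⟨ cong (_% m) (+-comm t _) ⟩
    ((q + p) % m + t) % m   ∎)
    where open ≡-Reasoning

  view-0 : ∀ f → view 0 f ≗ f
  view-0 f t t<m = cong f (m<n⇒m%n≡m t<m)

  view-≗ : ∀ p {f g} → f ≗ g → view p f ≗ view p g
  view-≗ p f≗g t _ = f≗g _ (m%n<n (p + t) m)

  -- Rotation preserves the three gaps up to their cyclic order. How many of `i < j < k` wrap past
  -- `m` decides which one becomes the smallest position, hence where the cyclic order of the gaps
  -- is cut.
  triFree-view : ∀ {P : ℕ → Set} {s} → s < m → TriFree P → TriFree (λ t → P ((s + t) % m))
  triFree-view {P} {s} s<m tri {i} {j} {k} p q r ip jq kr 1≤p 1≤q k<m Pi Pj Pk =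
    aux Pi Pj Pk (shifted s<m (<-trans i<j (<-trans j<k k<m))) (shifted s<m (<-trans j<k k<m)) (shifted s<m k<m)
    where
    i<j : i < j
    i<j = gap⇒< ip 1≤p
    j<k : j < k
    j<k = gap⇒< jq 1≤q
    1≤r : 1 ≤ r
    1≤r = linear 4 (λ i k r m → k :+ r :≡ i :+ m :⇒ k :< m :⇒ goal (con 1 :≤ r)) i k r m kr k<m
    push : ∀ {a b g} → a + g ≡ b → s + a + g ≡ s + b
    push {a} {b} {g} = linear 4 (λ s a b g → a :+ g :≡ b :⇒ goal (s :+ a :+ g :≡ s :+ b)) s a b g
    wrap : ∀ {a b g u v} → a + g ≡ b → u + m ≡ s + a → v + m ≡ s + b → u + g ≡ v
    wrap {a} {b} {g} {u} {v} = linear 7 (λ m s a b g u v → a :+ g :≡ b :⇒ u :+ m :≡ s :+ a :⇒ v :+ m :≡ s :+ b :⇒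
      goal (u :+ g :≡ v)) m s a b g u v
    cross : ∀ {a b g v} → a + g ≡ b → v + m ≡ s + b → s + a + g ≡ v + m
    cross {a} {b} {g} {v} = linear 6 (λ m s a b g v → a :+ g :≡ b :⇒ v :+ m :≡ s :+ b :⇒
      goal (s :+ a :+ g :≡ v :+ m)) m s a b g v
    close : ∀ {v} → v + m ≡ s + k → v + r ≡ s + i
    close {v} = linear 6 (λ m s i k r v → k :+ r :≡ i :+ m :⇒ v :+ m :≡ s :+ k :⇒
      goal (v :+ r :≡ s :+ i)) m s i k r v kr
    late : ∀ {a b u} → a < b → u + m ≡ s + a → ¬ (s + b < m)
    late {a} {b} {u} = linear 5 (λ m s a b u → a :< b :⇒ u :+ m :≡ s :+ a :⇒ s :+ b :< m :⇒ goal falsum) m s a b u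
    rotate : ∀ {A B C : Set} → A ⊎ B ⊎ C → B ⊎ C ⊎ A
    rotate (inj₁ a)        = inj₂ (inj₂ a)
    rotate (inj₂ (inj₁ b)) = inj₁ b
    rotate (inj₂ (inj₂ c)) = inj₂ (inj₁ c)
    aux : ∀ {i′ j′ k′} → P i′ → P j′ → P k′ → Shifted s i i′ → Shifted s j j′ → Shifted s k k′ →
          Backward p ⊎ Backward q ⊎ Backward r
    aux Pi Pj Pk (straight _) (straight _) (straight k′<m) =
      tri p q r (push ip) (push jq) (trans (push kr) (sym (+-assoc s i m))) 1≤p 1≤q k′<m Pi Pj Pk
    aux Pi Pj Pk (straight _) (straight j′<m) (wrapped w w≡) =
      rotate (tri r p q (close w≡) (push ip) (cross jq w≡) 1≤r 1≤p j′<m Pk Pi Pj)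
    aux Pi Pj Pk (straight i′<m) (wrapped v v≡) (wrapped w w≡) =
      rotate (rotate (tri q r p (wrap jq v≡ w≡) (close w≡) (cross ip v≡) 1≤q 1≤r i′<m Pj Pk Pi))
    aux Pi Pj Pk (wrapped u u≡) (wrapped v v≡) (wrapped w w≡) =
      tri p q r (wrap ip u≡ v≡) (wrap jq v≡ w≡) kr′ 1≤p 1≤q w<m Pi Pj Pk
      where
      kr′ : w + r ≡ u + m
      kr′ = trans (close w≡) (sym u≡)
      w<m : w < m
      w<m = linear 4 (λ m s k w → w :+ m :≡ s :+ k :⇒ s :< m :⇒ k :< m :⇒ goal (w :< m)) m s k w w≡ s<m k<m
    -- Wrapping is monotone: if a point wraps, so does every larger one.
    aux _ _ _ (wrapped u u≡) (straight j′<m) _ = contradiction j′<m (late i<j u≡)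
    aux _ _ _ _ (wrapped v v≡) (straight k′<m) = contradiction k′<m (late j<k v≡)

  good-view : ∀ {s f} → s < m → Good f → Good (view s f)
  good-view s<m good x = triFree-view s<m (good x)

  shift-injective : ∀ {s t t′} → s < m → t < m → t′ < m → (s + t) % m ≡ (s + t′) % m → t ≡ t′
  shift-injective {s} {t} {t′} s<m t<m t′<m eq = aux eq (shifted s<m t<m) (shifted s<m t′<m)
    where
    aux : ∀ {u u′} → u ≡ u′ → Shifted s t u → Shifted s t′ u′ → t ≡ t′
    aux eq (straight _) (straight _) = +-cancelˡ-≡ s t t′ eq
    aux refl (wrapped u u≡) (wrapped _ u≡′) = +-cancelˡ-≡ s t t′ (trans (sym u≡) u≡′)
    aux refl (straight _) (wrapped _ u≡) = ⊥-elim
      (linear 4 (λ m s t t′ → s :+ t :+ m :≡ s :+ t′ :⇒ t′ :< m :⇒ goal falsum) m s t t′ u≡ t′<m)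
    aux refl (wrapped _ u≡) (straight _) = ⊥-elim
      (linear 4 (λ m s t t′ → s :+ t :+ m :≡ s :+ t′ :⇒ t′ :< m :⇒ goal falsum) m s t′ t u≡ t<m)

  shift-surjective : ∀ {s} v → s < m → v < m → ∃[ t ] t < m × (s + t) % m ≡ v
  shift-surjective {s} v s<m v<m with m≤n⇒∃[o]m+o≡n (<⇒≤ s<m)
  ... | d , s+d≡m = (d + v) % m , m%n<n (d + v) m , (begin
    (s + (d + v) % m) % m   ≡⟨ %-absorb s (d + v) ⟩
    (s + (d + v)) % m       ≡⟨ cong (_% m) (trans (sym (+-assoc s d v)) (trans (cong (_+ v) s+d≡m) (+-comm m v))) ⟩
    (v + m) % m             ≡⟨ [m+n]%n≡m%n v m ⟩
    v % m                   ≡⟨ m<n⇒m%n≡m v<m ⟩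
    v                       ∎)
    where open ≡-Reasoning

  view-walk : ∀ {f g k s} → s < m → Walk f g k → Walk (view s f) (view s g) k
  view-walk {s = s} s<m (done f≗g) = done (view-≗ s f≗g)
  view-walk {f} {s = s} s<m (step {h} v v<m fv≢ same good w) with shift-surjective v s<m v<m
  ... | t , t<m , eq = step t t<m (fv≢ ∘ subst (λ u → f u ≡ h u) eq)
    (λ t′ t′<m t′≢t → same _ (m%n<n (s + t′) m) λ eq′ → t′≢t (shift-injective s<m t′<m t<m (trans eq′ (sym eq))))
    (good-view s<m good) (view-walk s<m w)

  count : Colour → (ℕ → Colour) → ℕ
  count x f = sum m (λ t → ind (f t ≟ᶜ x))

  sum-shift : ∀ φ {s} → s < m → sum m (λ t → φ ((s + t) % m)) ≡ sum m φ
  sum-shift φ {s} s<m with ≤⇒∃+ (<⇒≤ s<m)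
  ... | d , d+s≡m = begin
    sum m (λ t → φ ((s + t) % m))                      ≡⟨ cong (λ k → sum k (λ t → φ ((s + t) % m))) d+s≡m ⟨
    sum (d + s) (λ t → φ ((s + t) % m))                ≡⟨ sum-split d s _ ⟩
    sum d (λ t → φ ((s + t) % m)) + sum s (λ t → φ ((s + (d + t)) % m))
                                                       ≡⟨ cong₂ _+_ (sum-cong d low) (sum-cong s high) ⟩
    sum d (λ t → φ (s + t)) + sum s φ                  ≡⟨ +-comm _ (sum s φ) ⟩
    sum s φ + sum d (λ t → φ (s + t))                  ≡⟨ sum-split s d φ ⟨
    sum (s + d) φ                                      ≡⟨ cong (λ k → sum k φ) (trans (+-comm s d) d+s≡m) ⟩
    sum m φ                                            ∎
    where
    open ≡-Reasoning
    low : ∀ t → t < d → φ ((s + t) % m) ≡ φ (s + t)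
    low t t<d = cong φ (m<n⇒m%n≡m (subst (s + t <_) (trans (+-comm s d) d+s≡m) (+-monoʳ-< s t<d)))
    high : ∀ t → t < s → φ ((s + (d + t)) % m) ≡ φ t
    high t t<s = cong φ (trans (cong (_% m) (linear 4 (λ m s d t → d :+ s :≡ m :⇒ goal (s :+ (d :+ t) :≡ t :+ m)) m s d t d+s≡m))
      (trans ([m+n]%n≡m%n t m) (m<n⇒m%n≡m (<-trans t<s s<m))))

  count-view : ∀ x f {s} → s < m → count x (view s f) ≡ count x f
  count-view x f = sum-shift (λ t → ind (f t ≟ᶜ x))

-- From triangle-free classes to acyclic ones, and from walks to paths in the dicoloring graph

module Conversion (n : ℕ) (5≤n : 5 ≤ n) where
  open Circle n

  -- The gap from `a` to `b` on the circle as an equation, free of the truncated subtraction and the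
  -- remainder in `circDiff`.
  data Offset (a b d : ℕ) : Set where
    ahead  : a + d ≡ b → Offset a b d
    around : a + d ≡ b + m → Offset a b d

  offset-circDiff : ∀ {a b : Fin m} {d} → Offset (toℕ a) (toℕ b) d → d < m → circDiff n a b ≡ d
  offset-circDiff {a} {b} {d} (ahead a+d≡b) d<m = begin
    (toℕ b + m ∸ toℕ a) % m         ≡⟨ cong (λ v → (v + m ∸ toℕ a) % m) a+d≡b ⟨
    (toℕ a + d + m ∸ toℕ a) % m     ≡⟨ cong (λ v → (v ∸ toℕ a) % m) (+-assoc (toℕ a) d m) ⟩
    (toℕ a + (d + m) ∸ toℕ a) % m   ≡⟨ cong (_% m) (m+n∸m≡n (toℕ a) (d + m)) ⟩
    (d + m) % m                     ≡⟨ [m+n]%n≡m%n d m ⟩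
    d % m                           ≡⟨ m<n⇒m%n≡m d<m ⟩
    d                               ∎
    where open ≡-Reasoning
  offset-circDiff {a} {b} {d} (around a+d≡b+m) d<m = begin
    (toℕ b + m ∸ toℕ a) % m         ≡⟨ cong (λ v → (v ∸ toℕ a) % m) a+d≡b+m ⟨
    (toℕ a + d ∸ toℕ a) % m         ≡⟨ cong (_% m) (m+n∸m≡n (toℕ a) d) ⟩
    d % m                           ≡⟨ m<n⇒m%n≡m d<m ⟩
    d                               ∎
    where open ≡-Reasoning

  circDiff-offset : ∀ (a b : Fin m) → ∃[ d ] d < m × Offset (toℕ a) (toℕ b) d
  circDiff-offset a b with toℕ a ≤? toℕ b
  ... | yes a≤b with m≤n⇒∃[o]m+o≡n a≤b
  ...   | d , a+d≡b = d , ≤-<-trans (≤-trans (m≤n+m d (toℕ a)) (≤-reflexive a+d≡b)) (Fin.toℕ<n b) , ahead a+d≡b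
  circDiff-offset a b | no a≰b with m≤n⇒∃[o]m+o≡n (≤-trans (<⇒≤ (Fin.toℕ<n a)) (m≤n+m m (toℕ b)))
  ... | d , a+d≡b+m = d ,
    linear 4 (λ m a b d → a :+ d :≡ b :+ m :⇒ b :< a :⇒ goal (d :< m)) m (toℕ a) (toℕ b) d a+d≡b+m (≰⇒> a≰b) ,
    around a+d≡b+m

  arc-offset : ∀ {a b : Fin m} → CArc n a b → ∃[ d ] 1 ≤ d × Forward d × Offset (toℕ a) (toℕ b) d
  arc-offset {a} {b} arc with circDiff-offset a b
  ... | d , d<m , off = d , proj₁ forward , proj₂ forward , off
    where
    n∸1<n : ∀ k → 5 ≤ k → ∀ {e} → e ≤ k ∸ 1 → suc e ≤ k
    n∸1<n (suc k) _ = s≤s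
    read : ∀ {e} → (1 ≤ e × e ≤ n ∸ 1) ⊎ e ≡ suc n → 1 ≤ e × Forward e
    read (inj₁ (1≤e , e≤)) = 1≤e , inj₁ (n∸1<n n 5≤n e≤)
    read (inj₂ refl)       = s≤s z≤n , inj₂ refl
    forward : 1 ≤ d × Forward d
    forward = read (subst (λ e → (1 ≤ e × e ≤ n ∸ 1) ⊎ e ≡ suc n) (offset-circDiff off d<m) arc)

  forward-bound : ∀ {g} → Forward g → g ≤ suc n
  forward-bound (inj₁ g<n)  = ≤-trans (<⇒≤ g<n) (n≤1+n n)
  forward-bound (inj₂ refl) = ≤-refl

  offset-arc : ∀ {a b : Fin m} d → 1 ≤ d → Forward d → Offset (toℕ a) (toℕ b) d → CArc n a b
  offset-arc {a} {b} d 1≤d fwd off = subst (λ e → (1 ≤ e × e ≤ n ∸ 1) ⊎ e ≡ suc n) (sym (offset-circDiff off d<m)) (write fwd)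
    where
    d<m : d < m
    d<m = linear 2 (λ n d → con 5 :≤ n :⇒ d :≤ con 1 :+ n :⇒ goal (d :< :m n)) n d 5≤n (forward-bound fwd)
    write : Forward d → (1 ≤ d × d ≤ n ∸ 1) ⊎ d ≡ suc n
    write (inj₁ d<n)   = inj₁ (1≤d , <⇒≤pred d<n)
    write (inj₂ d≡1+n) = inj₂ d≡1+n

  -- The number of `around` offsets is the winding number of the triangle. It is positive because
  -- the gaps are, and at least 2 would need gaps of total 2m, while three forward gaps give at most
  -- 3n + 3. So it is 1, and the position of the single `around` tells which vertex is the smallest.
  triFree-noTriangle : ∀ {P : ℕ → Set} → TriFree P → ∀ (x y z : Fin m) → P (toℕ x) → P (toℕ y) → P (toℕ z) →
                       CArc n x y → CArc n y z → ¬ CArc n z x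
  triFree-noTriangle {P} tri x y z Px Py Pz xy yz zx with arc-offset xy | arc-offset yz | arc-offset zx
  ... | p , 1≤p , fp , op | q , 1≤q , fq , oq | r , 1≤r , fr , or =
    aux op oq or
    where
    refuted : ∀ {p q r} → Forward p → Forward q → Forward r → ¬ (Backward p ⊎ Backward q ⊎ Backward r)
    refuted fp fq fr (inj₁ b)        = forward⇒¬backward fp b
    refuted fp fq fr (inj₂ (inj₁ b)) = forward⇒¬backward fq b
    refuted fp fq fr (inj₂ (inj₂ b)) = forward⇒¬backward fr b
    atMostOne : 2 * m ≤ p + q + r → ⊥
    atMostOne = λ h → linear 4 (λ n p q r → con 5 :≤ n :⇒ p :≤ con 1 :+ n :⇒ q :≤ con 1 :+ n :⇒ r :≤ con 1 :+ n :⇒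
      2 :* :m n :≤ p :+ q :+ r :⇒ goal falsum) n p q r 5≤n (forward-bound fp) (forward-bound fq) (forward-bound fr) h
    X = toℕ x
    Y = toℕ y
    Z = toℕ z
    two : ∀ a b c {p q r} → a + p ≡ b + m → b + q ≡ c + m → c + r ≡ a → 2 * m ≤ p + q + r
    two a b c {p} {q} {r} = linear 7 (λ m a b c p q r → a :+ p :≡ b :+ m :⇒ b :+ q :≡ c :+ m :⇒ c :+ r :≡ a :⇒
      goal (2 :* m :≤ p :+ q :+ r)) m a b c p q r
    aux : Offset X Y p → Offset Y Z q → Offset Z X r → ⊥
    aux (ahead e₁) (ahead e₂) (around e₃) =
      refuted fp fq fr (tri p q r e₁ e₂ e₃ 1≤p 1≤q (Fin.toℕ<n z) Px Py Pz)
    aux (ahead e₁) (around e₂) (ahead e₃) =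
      refuted fr fp fq (tri r p q e₃ e₁ e₂ 1≤r 1≤p (Fin.toℕ<n y) Pz Px Py)
    aux (around e₁) (ahead e₂) (ahead e₃) =
      refuted fq fr fp (tri q r p e₂ e₃ e₁ 1≤q 1≤r (Fin.toℕ<n x) Py Pz Px)
    aux (ahead e₁) (ahead e₂) (ahead e₃) = linear 6 (λ a b c p q r → a :+ p :≡ b :⇒ b :+ q :≡ c :⇒ c :+ r :≡ a :⇒
      con 1 :≤ p :⇒ goal falsum) X Y Z p q r e₁ e₂ e₃ 1≤p
    aux (around e₁) (around e₂) (ahead e₃) = atMostOne (two X Y Z e₁ e₂ e₃)
    aux (ahead e₁) (around e₂) (around e₃) = atMostOne (subst (2 * m ≤_) (cycle q r p) (two Y Z X e₂ e₃ e₁))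
      where
      cycle : ∀ a b c → a + b + c ≡ c + a + b
      cycle = solve-∀
    aux (around e₁) (ahead e₂) (around e₃) = atMostOne (subst (2 * m ≤_) (cycle r p q) (two Z X Y e₃ e₁ e₂))
      where
      cycle : ∀ a b c → a + b + c ≡ b + c + a
      cycle = solve-∀
    aux (around e₁) (around e₂) (around e₃) = atMostOne
      (linear 7 (λ m a b c p q r → a :+ p :≡ b :+ m :⇒ b :+ q :≡ c :+ m :⇒ c :+ r :≡ a :+ m :⇒
        goal (2 :* m :≤ p :+ q :+ r)) m X Y Z p q r e₁ e₂ e₃)

  -- Opposite arcs would have forward gaps of sum `m`. If one gap is below `n`, the sum is at most
  -- 2n; otherwise both are n + 1 and the sum is m + 1.
  arc-asym : ∀ (x y : Fin m) → CArc n x y → ¬ CArc n y x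
  arc-asym x y xy yx with arc-offset xy | arc-offset yx
  ... | p , 1≤p , fp , op | q , 1≤q , fq , oq = aux fp fq op oq
    where
    X = toℕ x
    Y = toℕ y
    total : Forward p → Forward q → p + q ≢ m
    total (inj₁ p<n) fq e = linear 3 (λ n p q → p :< n :⇒ q :≤ con 1 :+ n :⇒ p :+ q :≡ :m n :⇒ goal falsum)
      n p q p<n (forward-bound fq) e
    total fp (inj₁ q<n) e = linear 3 (λ n p q → q :< n :⇒ p :≤ con 1 :+ n :⇒ p :+ q :≡ :m n :⇒ goal falsum)
      n p q q<n (forward-bound fp) e
    total (inj₂ p≡) (inj₂ q≡) e = linear 3 (λ n p q → p :≡ con 1 :+ n :⇒ q :≡ con 1 :+ n :⇒ p :+ q :≡ :m n :⇒ goal falsum)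
      n p q p≡ q≡ e
    aux : Forward p → Forward q → Offset X Y p → Offset Y X q → ⊥
    aux _ _ (ahead e₁) (ahead e₂) =
      linear 4 (λ a b p q → a :+ p :≡ b :⇒ b :+ q :≡ a :⇒ con 1 :≤ p :⇒ goal falsum) X Y p q e₁ e₂ 1≤p
    aux fp fq (around e₁) (around e₂) =
      linear 5 (λ n a b p q → con 5 :≤ n :⇒ p :≤ con 1 :+ n :⇒ q :≤ con 1 :+ n :⇒ a :+ p :≡ b :+ :m n :⇒
        b :+ q :≡ a :+ :m n :⇒ goal falsum) n X Y p q 5≤n (forward-bound fp) (forward-bound fq) e₁ e₂
    aux fp fq (ahead e₁) (around e₂) = total fp fq
      (linear 5 (λ m a b p q → a :+ p :≡ b :⇒ b :+ q :≡ a :+ m :⇒ goal (p :+ q :≡ m)) m X Y p q e₁ e₂)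
    aux fp fq (around e₁) (ahead e₂) = total fp fq
      (linear 5 (λ m a b p q → b :+ q :≡ a :⇒ a :+ p :≡ b :+ m :⇒ goal (p :+ q :≡ m)) m X Y p q e₂ e₁)

  arc-total : ∀ (x y : Fin m) → x ≢ y → CArc n x y ⊎ CArc n y x
  arc-total x y x≢y with circDiff-offset x y
  ... | d , d<m , off with backward⊎forward d
  ...   | inj₂ fwd = inj₁ (offset-arc d (positive off) fwd off)
    where
    positive : ∀ {d} → Offset (toℕ x) (toℕ y) d → 1 ≤ d
    positive {zero}  (ahead e)  = contradiction (Fin.toℕ-injective (trans (sym (+-identityʳ _)) e)) x≢y
    positive {zero}  (around e) = contradiction (subst (_< m) (trans (sym (+-identityʳ _)) e) (Fin.toℕ<n x)) (≤⇒≯ (m≤n+m m (toℕ y)))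
    positive {suc d} _          = s≤s z≤n
  ...   | inj₁ bwd with ≤⇒∃+ (<⇒≤ d<m)
  ...     | e , e+d≡m = inj₂ (offset-arc e 1≤e (opposite bwd) (flip off))
    where
    1≤e : 1 ≤ e
    1≤e = linear 3 (λ m d e → e :+ d :≡ m :⇒ d :< m :⇒ goal (con 1 :≤ e)) m d e e+d≡m d<m
    opposite : Backward d → Forward e
    opposite (inj₁ d≡n)   = inj₂ (linear 3 (λ n d e → e :+ d :≡ :m n :⇒ d :≡ n :⇒ goal (e :≡ con 1 :+ n)) n d e e+d≡m d≡n)
    opposite (inj₂ n+2≤d) = inj₁ (linear 3 (λ n d e → e :+ d :≡ :m n :⇒ con 2 :+ n :≤ d :⇒ goal (e :< n)) n d e e+d≡m n+2≤d)
    flip : Offset (toℕ x) (toℕ y) d → Offset (toℕ y) (toℕ x) e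
    flip (ahead h)  = around (linear 5 (λ m a b d e → e :+ d :≡ m :⇒ a :+ d :≡ b :⇒ goal (b :+ e :≡ a :+ m))
      m (toℕ x) (toℕ y) d e e+d≡m h)
    flip (around h) = ahead (linear 5 (λ m a b d e → e :+ d :≡ m :⇒ a :+ d :≡ b :+ m :⇒ goal (b :+ e :≡ a))
      m (toℕ x) (toℕ y) d e e+d≡m h)

  -- In a tournament a closed walk can be shortened along a chord until a triangle appears.
  triFree-noClosedWalk : ∀ {P : ℕ → Set} → TriFree P → ∀ x xs → All (P ∘ toℕ) (x ∷ xs) →
                         Linked (CArc n) (x ∷ xs) → ¬ CArc n (lastOf x xs) x
  triFree-noClosedWalk tri x [] _ _ xx = arc-asym x x xx xx
  triFree-noClosedWalk tri x (y ∷ []) _ (xy ∷ _) yx = arc-asym x y xy yx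
  triFree-noClosedWalk tri x (y ∷ z ∷ zs) (Px ∷ Py ∷ Pz ∷ Pzs) (xy ∷ yz ∷ zzs) closing =
    chord (λ xz → triFree-noClosedWalk tri x (z ∷ zs) (Px ∷ Pz ∷ Pzs) (xz ∷ zzs) closing)
    where
    -- If the arc joins `z` to `x` instead, it closes a directed triangle with `x y` and `y z`. The
    -- double negation suffices because the goal is a contradiction.
    chord : ¬ ¬ CArc n x z
    chord ¬xz with x Fin.≟ z
    ... | yes refl = arc-asym x y xy yz
    ... | no x≢z   = [ ¬xz , triFree-noTriangle tri x y z Px Py Pz xy yz ]′ (arc-total x z x≢z)

  fromGood : ∀ f → Good f → Coloring (Ctour n) 3
  fromGood f good = record
    { col     = f ∘ toℕ
    ; acyclic = λ { c (x , xs , _ , all , linked , closing) → triFree-noClosedWalk (good c) x xs all linked closing }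
    }

  extend : Coloring (Ctour n) 3 → ℕ → Colour
  extend α t = col α (t mod m)

  extend-toℕ : ∀ α v → extend α (toℕ v) ≡ col α v
  extend-toℕ α v = cong (col α) (Fin.toℕ-injective (trans (Fin.toℕ-fromℕ< _) (m<n⇒m%n≡m (Fin.toℕ<n v))))

  extend-good : ∀ α → Good (extend α)
  extend-good α c {i} {j} {k} p q r ip jq kr 1≤p 1≤q k<m ci cj ck
    with backward⊎forward p | backward⊎forward q | backward⊎forward r
  ... | inj₁ bp | _       | _       = inj₁ bp
  ... | inj₂ _  | inj₁ bq | _       = inj₂ (inj₁ bq)
  ... | inj₂ _  | inj₂ _  | inj₁ br = inj₂ (inj₂ br)
  ... | inj₂ fp | inj₂ fq | inj₂ fr = ⊥-elim (acyclic α c (x , y ∷ z ∷ [] ,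
          ((x≢ i<m j<m (<⇒≢ i<j) ∷ x≢ i<m k<m (<⇒≢ (<-trans i<j j<k)) ∷ []) ∷ (x≢ j<m k<m (<⇒≢ j<k) ∷ []) ∷ [] ∷ []) ,
          ci ∷ cj ∷ ck ∷ [] ,
          offset-arc p 1≤p fp (ahead (at i<m j<m ip)) ∷ offset-arc q 1≤q fq (ahead (at j<m k<m jq)) ∷ [-] ,
          offset-arc r 1≤r fr (around (trans (cong (_+ r) (here′ k<m)) (trans kr (cong (_+ m) (sym (here′ i<m))))))))
    where
    x y z : Fin m
    x = i mod m
    y = j mod m
    z = k mod m
    i<j : i < j
    i<j = gap⇒< ip 1≤p
    j<k : j < k
    j<k = gap⇒< jq 1≤q
    1≤r : 1 ≤ r
    1≤r = linear 4 (λ i k r m → k :+ r :≡ i :+ m :⇒ k :< m :⇒ goal (con 1 :≤ r)) i k r m kr k<m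
    j<m : j < m
    j<m = <-trans j<k k<m
    i<m : i < m
    i<m = <-trans i<j j<m
    here′ : ∀ {t} → t < m → toℕ (t mod m) ≡ t
    here′ t<m = trans (Fin.toℕ-fromℕ< _) (m<n⇒m%n≡m t<m)
    at : ∀ {a b g} → a < m → b < m → a + g ≡ b → toℕ (a mod m) + g ≡ toℕ (b mod m)
    at {g = g} a<m b<m eq = trans (cong (_+ g) (here′ a<m)) (trans eq (sym (here′ b<m)))
    x≢ : ∀ {a b} → a < m → b < m → a ≢ b → a mod m ≢ b mod m
    x≢ a<m b<m a≢b eq = a≢b (trans (sym (here′ a<m)) (trans (cong toℕ eq) (here′ b<m)))

  -- The start is known only up to `≗`: after one step the colouring built by `fromGood` returns to
  -- `h` through a remainder, which agrees with `h` below `m` only.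
  toWalk : ∀ {f k} (α β : Coloring (Ctour n) 3) → Walk f (extend β) k → f ≗ extend α → WalkOfLength α β k
  toWalk α β (done f≗β) f≗α = here λ v →
    trans (sym (extend-toℕ α v)) (trans (sym (f≗α _ (Fin.toℕ<n v))) (trans (f≗β _ (Fin.toℕ<n v)) (extend-toℕ β v)))
  toWalk {f} α β (step {h} v v<m fv≢ same good w) f≗α = step
    (fromℕ< v<m ,
     (λ eq → fv≢ (trans (sym agree) (trans eq (cong h (Fin.toℕ-fromℕ< v<m))))) ,
     λ u u≢v → trans (sym (extend-toℕ α u)) (trans (sym (f≗α _ (Fin.toℕ<n u))) (same _ (Fin.toℕ<n u) (u≢v ∘ index))))
    (toWalk (fromGood h good) β w λ t t<m → cong h (sym (trans (Fin.toℕ-fromℕ< _) (m<n⇒m%n≡m t<m))))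
    where
    agree : col α (fromℕ< v<m) ≡ f v
    agree = begin
      col α (fromℕ< v<m)                 ≡⟨ extend-toℕ α (fromℕ< v<m) ⟨
      extend α (toℕ (fromℕ< v<m))        ≡⟨ cong (extend α) (Fin.toℕ-fromℕ< v<m) ⟩
      extend α v                         ≡⟨ f≗α v v<m ⟨
      f v                                ∎
      where open ≡-Reasoning
    index : ∀ {u} → toℕ u ≡ v → u ≡ fromℕ< v<m
    index eq = Fin.toℕ-injective (trans eq (sym (Fin.toℕ-fromℕ< v<m)))

-- Three colours and purification of a full window

Distinct : Colour → Colour → Colour → Set
Distinct c d e = c ≢ d × c ≢ e × d ≢ e

exhaustive : ∀ {c d e} → Distinct c d e → ∀ x → x ≡ c ⊎ x ≡ d ⊎ x ≡ e
exhaustive {c} {d} {e} = λ dist x → toWitness {a? = decision} _ c d e dist x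
  where
  decision = Fin.all? λ c → Fin.all? λ d → Fin.all? λ e →
    (¬? (c ≟ᶜ d) ×-dec ¬? (c ≟ᶜ e) ×-dec ¬? (d ≟ᶜ e)) →-dec
    Fin.all? λ x → (x ≟ᶜ c) ⊎-dec (x ≟ᶜ d) ⊎-dec (x ≟ᶜ e)

third : ∀ x y → ∃[ z ] z ≢ x × z ≢ y
third = toWitness {a? = Fin.all? λ x → Fin.all? λ y → Fin.any? λ z → ¬? (z ≟ᶜ x) ×-dec ¬? (z ≟ᶜ y)} _

module Route (n : ℕ) (5≤n : 5 ≤ n) where
  open Circle n
  open View n

  opaque
    pure : Colour → Colour → Colour → ℕ → Colour
    pure c d e t with <-cmp t n
    ... | tri< _ _ _ = c
    ... | tri≈ _ _ _ = d
    ... | tri> _ _ _ = e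

  opaque
    unfolding pure

    pure-inv : ∀ {c d e} t {x} → pure c d e t ≡ x → (t < n × c ≡ x) ⊎ (t ≡ n × d ≡ x) ⊎ (n < t × e ≡ x)
    pure-inv t eq with <-cmp t n
    ... | tri< t<n _ _ = inj₁ (t<n , eq)
    ... | tri≈ _ t≡n _ = inj₂ (inj₁ (t≡n , eq))
    ... | tri> _ _ n<t = inj₂ (inj₂ (n<t , eq))

    pure-< : ∀ {c d e t} → t < n → pure c d e t ≡ c
    pure-< {t = t} t<n with <-cmp t n
    ... | tri< _ _ _   = refl
    ... | tri≈ t≮n _ _ = contradiction t<n t≮n
    ... | tri> t≮n _ _ = contradiction t<n t≮n

    pure-≡ : ∀ {c d e t} → t ≡ n → pure c d e t ≡ d
    pure-≡ {t = t} t≡n with <-cmp t n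
    ... | tri< _ t≢n _ = contradiction t≡n t≢n
    ... | tri≈ _ _ _   = refl
    ... | tri> _ t≢n _ = contradiction t≡n t≢n

    pure-> : ∀ {c d e t} → n < t → pure c d e t ≡ e
    pure-> {t = t} n<t with <-cmp t n
    ... | tri< _ _ n≮t = contradiction n<t n≮t
    ... | tri≈ _ _ n≮t = contradiction n<t n≮t
    ... | tri> _ _ _   = refl

  -- This makes the intermediate phases of a purification free: each phase only gives vertices their
  -- final colour, so the lengths add up to the Hamming distance.
  between : ∀ {f g h} → (∀ t → t < m → g t ≡ f t ⊎ g t ≡ h t) → distance f g + distance g h ≡ distance f h
  between {f} {g} {h} btw = trans (sym (sum-+ m _ _)) (sum-cong m pointwise)
    where
    pointwise : ∀ t → t < m → differ (f t) (g t) + differ (g t) (h t) ≡ differ (f t) (h t)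
    pointwise t t<m with btw t t<m
    ... | inj₁ gt≡ft = cong₂ _+_ (differ-≡ (sym gt≡ft)) (cong (λ x → differ x (h t)) gt≡ft)
    ... | inj₂ gt≡ht = trans (cong₂ _+_ (cong (differ (f t)) gt≡ht) (differ-≡ gt≡ht)) (+-identityʳ _)

  paint-between : ∀ {f} a l x {h : ℕ → Colour} → (∀ t → a ≤ t → t < a + l → h t ≡ x) →
                  ∀ t → t < m → paint f a l x t ≡ f t ⊎ paint f a l x t ≡ h t
  paint-between {f} a l x on t _ with paint-inv {f} {a} {l} {x} {t} refl
  ... | inj₁ (x≡ , a≤t , t<b) = inj₂ (trans (sym x≡) (sym (on t a≤t t<b)))
  ... | inj₂ (f≡ , _)         = inj₁ (sym f≡)

  2n<m : 2 * n < m
  2n<m = ≤-refl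

  last : ∀ {t} → t < m → ¬ (t < 2 * n) → t ≡ 2 * n
  last t<m t≮2n = ≤-antisym (m<1+n⇒m≤n t<m) (≮⇒≥ t≮2n)

  single : ∀ {a t} → a ≤ t → t < a + 1 → t ≡ a
  single {a} {t} = linear 2 (λ a t → a :≤ t :⇒ t :< a :+ con 1 :⇒ goal (t :≡ a)) a t

  OnWindow : Colour → (ℕ → Colour) → Set
  OnWindow c f = (∀ t → t < n → f t ≡ c) × (∀ t → n ≤ t → t < m → f t ≢ c)

  module _ {c d e : Colour} (dist : Distinct c d e) where

    private
      c≢d : c ≢ d
      c≢d = proj₁ dist
      c≢e : c ≢ e
      c≢e = proj₁ (proj₂ dist)
      d≢e : d ≢ e
      d≢e = proj₂ (proj₂ dist)

    -- Only changes to `e` remain, and the final `e`-class is the arc of `n` vertices starting at n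
    -- + 1.
    purify₁ : ∀ {f} → Good f → (∀ t → t < n → f t ≡ c) → f n ≡ d →
              Walk f (pure c d e) (distance f (pure c d e))
    purify₁ {f} good low fn≡d = recolour (pure c d e) e good change (triFree-arc (suc n) arc)
      where
      change : ∀ t → t < m → pure c d e t ≡ f t ⊎ pure c d e t ≡ e
      change t _ with pure-inv {c} {d} {e} t refl
      ... | inj₁ (t<n , c≡)         = inj₁ (trans (sym c≡) (sym (low t t<n)))
      ... | inj₂ (inj₁ (refl , d≡)) = inj₁ (trans (sym d≡) (sym fn≡d))
      ... | inj₂ (inj₂ (_ , e≡))    = inj₂ (sym e≡)
      arc : ∀ t → t < m → pure c d e t ≡ e → suc n ≤ t × t < suc n + n
      arc t t<m eq with pure-inv t eq
      ... | inj₁ (_ , c≡e)          = contradiction c≡e c≢e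
      ... | inj₂ (inj₁ (_ , d≡e))   = contradiction d≡e d≢e
      ... | inj₂ (inj₂ (n<t , _))   = n<t , linear 2 (λ n t → t :< :m n :⇒ goal (t :< con 1 :+ n :+ n)) n t t<m

    -- The vertex n turns from e to d only once the d-class fits with it,
    -- for which the vertices strictly between n and 2n may first have to become e.
    purify : ∀ {f} → Good f → (∀ t → t < n → f t ≡ c) → f n ≢ c →
             Walk f (pure c d e) (distance f (pure c d e))
    purify {f} good low fn≢c with f n ≟ᶜ d | f (2 * n) ≟ᶜ d
    ... | yes fn≡d | _ = purify₁ good low fn≡d
    -- As 2n is not in the `d`-class, adding `n` to that class keeps it within the `n` vertices
    -- `[n, 2n)`.
    ... | no fn≢d  | no f2n≢d =
      subst (Walk f _) (between {f} {f′} f′-between) (w ++ purify₁ (walk-good good w) low′ (paint-in ≤-refl n<n+1))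
      where
      n<n+1 : n < n + 1
      n<n+1 = ≤-reflexive (+-comm 1 n)
      f′ : ℕ → Colour
      f′ = paint f n 1 d
      arc : ∀ t → t < m → f′ t ≡ d → n ≤ t × t < n + n
      arc t t<m eq with paint-inv eq | t <? n
      ... | inj₁ (_ , n≤t , t<n+1) | _ = n≤t ,
        linear 2 (λ n t → t :< n :+ con 1 :⇒ con 5 :≤ n :⇒ goal (t :< n :+ n)) n t t<n+1 5≤n
      ... | inj₂ (ft≡d , _) | yes t<n = contradiction (trans (sym (low t t<n)) ft≡d) c≢d
      ... | inj₂ (ft≡d , _) | no t≮n with t <? 2 * n
      ...   | yes t<2n = ≮⇒≥ t≮n , linear 2 (λ n t → t :< 2 :* n :⇒ goal (t :< n :+ n)) n t t<2n
      ...   | no t≮2n  = contradiction (trans (cong f (sym (last t<m t≮2n))) ft≡d) f2n≢d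
      f′-between : ∀ t → t < m → f′ t ≡ f t ⊎ f′ t ≡ pure c d e t
      f′-between = paint-between n 1 d {pure c d e} λ t n≤t t<n+1 → pure-≡ (single n≤t t<n+1)
      w : Walk f f′ (distance f f′)
      w = recolour f′ d good (λ t _ → paint-or t) (triFree-arc n arc)
      low′ : ∀ t → t < n → f′ t ≡ c
      low′ t t<n = trans (paint-below t<n) (low t t<n)
    -- With `n` and 2n both coloured `d`, any `d`-vertex between them would complete a directed
    -- triangle, its gaps being p, n - p and n + 1. So those vertices become `e` before `n` becomes
    -- `d`. The larger `e`-class is harmless: it avoids 2n and stays in `[n, 2n)`.
    ... | no fn≢d  | yes f2n≡d with ≤⇒∃+ (≤-trans (s≤s z≤n) 5≤n)
    ...   | l , l+1≡n = subst (Walk f _) (trans (cong (distance f f₁ +_) (between {f₁} {f₂} f₂-between)) (between {f} {f₁} f₁-between))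
        (w₁ ++ w₂ ++ purify₁ (walk-good (walk-good good w₁) w₂) low₂ (paint-in ≤-refl n<n+1))
      where
      n<n+1 : n < n + 1
      n<n+1 = ≤-reflexive (+-comm 1 n)
      f₁ f₂ : ℕ → Colour
      f₁ = paint f (suc n) l e
      f₂ = paint f₁ n 1 d
      below-2n : ∀ {t} → t < suc n + l → t < n + n
      below-2n {t} = linear 3 (λ n l t → l :+ con 1 :≡ n :⇒ t :< con 1 :+ n :+ l :⇒ goal (t :< n :+ n)) n l t l+1≡n
      arc : ∀ t → t < m → f₁ t ≡ e → n ≤ t × t < n + n
      arc t t<m eq with paint-inv eq | t <? n
      ... | inj₁ (_ , n<t , t<2n) | _ = <⇒≤ n<t , below-2n t<2n
      ... | inj₂ (ft≡e , _) | yes t<n = contradiction (trans (sym (low t t<n)) ft≡e) c≢e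
      ... | inj₂ (ft≡e , _) | no t≮n with t <? 2 * n
      ...   | yes t<2n = ≮⇒≥ t≮n , linear 2 (λ n t → t :< 2 :* n :⇒ goal (t :< n :+ n)) n t t<2n
      ...   | no t≮2n  = contradiction (trans (sym f2n≡d) (trans (cong f (sym (last t<m t≮2n))) ft≡e)) d≢e
      pair : ∀ t → t < m → f₂ t ≡ d → t ≡ n ⊎ t ≡ 2 * n
      pair t t<m eq with paint-inv eq
      ... | inj₁ (_ , n≤t , t<n+1) = inj₁ (single n≤t t<n+1)
      ... | inj₂ (f₁t≡d , _) with paint-old (d≢e ∘ sym) f₁t≡d | t <? n
      ...   | ft≡d , _ | yes t<n = contradiction (trans (sym (low t t<n)) ft≡d) c≢d
      ...   | ft≡d , inj₁ t<n+1 | no t≮n = inj₁ (≤-antisym (m<1+n⇒m≤n t<n+1) (≮⇒≥ t≮n))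
      ...   | ft≡d , inj₂ 2n≤t  | no _   = inj₂ (linear 3 (λ n l t → l :+ con 1 :≡ n :⇒ con 1 :+ n :+ l :≤ t :⇒
              t :< :m n :⇒ goal (t :≡ 2 :* n)) n l t l+1≡n 2n≤t t<m)
      w₁ : Walk f f₁ (distance f f₁)
      w₁ = recolour f₁ e good (λ t _ → paint-or t) (triFree-arc n arc)
      w₂ : Walk f₁ f₂ (distance f₁ f₂)
      w₂ = recolour f₂ d (walk-good good w₁) (λ t _ → paint-or t) (triFree-pair n (2 * n) pair)
      f₁-between : ∀ t → t < m → f₁ t ≡ f t ⊎ f₁ t ≡ pure c d e t
      f₁-between = paint-between (suc n) l e {pure c d e} λ t n<t _ → pure-> n<t
      f₂-between : ∀ t → t < m → f₂ t ≡ f₁ t ⊎ f₂ t ≡ pure c d e t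
      f₂-between = paint-between n 1 d {pure c d e} λ t n≤t t<n+1 → pure-≡ (single n≤t t<n+1)
      low₂ : ∀ t → t < n → f₂ t ≡ c
      low₂ t t<n = trans (paint-below t<n) (trans (paint-below (m<n⇒m<1+n t<n)) (low t t<n))

    -- On each of the n + 1 vertices outside the window, `f` has colour `d` or `e` and so agrees
    -- with one of the two target patterns; on the window it agrees with both.
    purify-cost : ∀ {f} → OnWindow c f → distance f (pure c d e) + distance f (pure c e d) ≤ suc n
    purify-cost {f} (low , high) = ≤-trans (≤-reflexive (sym (sum-+ m _ _)))
      (sum-support m n (suc n) at-most-one outside)
      where
      φ : ℕ → ℕ
      φ t = differ (f t) (pure c d e t) + differ (f t) (pure c e d t)
      φ-low : ∀ t → t < n → φ t ≡ 0
      φ-low t t<n = cong₂ _+_ (differ-≡ (trans (low t t<n) (sym (pure-< t<n)))) (differ-≡ (trans (low t t<n) (sym (pure-< t<n))))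
      agree : ∀ t → f t ≡ pure c d e t ⊎ f t ≡ pure c e d t → φ t ≤ 1
      agree t (inj₁ eq) = subst (λ k → k + differ (f t) (pure c e d t) ≤ 1) (sym (differ-≡ eq)) (differ≤1 (f t) _)
      agree t (inj₂ eq) = subst (λ k → differ (f t) (pure c d e t) + k ≤ 1) (sym (differ-≡ eq))
        (subst (_≤ 1) (sym (+-identityʳ _)) (differ≤1 (f t) _))
      at-most-one : ∀ t → t < m → φ t ≤ 1
      at-most-one t t<m with t <? n
      ... | yes t<n = ≤-trans (≤-reflexive (φ-low t t<n)) z≤n
      ... | no t≮n with exhaustive dist (f t) | <-cmp t n
      ...   | inj₁ ft≡c        | _            = contradiction ft≡c (high t (≮⇒≥ t≮n) t<m)
      ...   | inj₂ _           | tri< t<n _ _ = contradiction t<n t≮n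
      ...   | inj₂ (inj₁ ft≡d) | tri≈ _ t≡n _ = agree t (inj₁ (trans ft≡d (sym (pure-≡ t≡n))))
      ...   | inj₂ (inj₂ ft≡e) | tri≈ _ t≡n _ = agree t (inj₂ (trans ft≡e (sym (pure-≡ t≡n))))
      ...   | inj₂ (inj₁ ft≡d) | tri> _ _ n<t = agree t (inj₂ (trans ft≡d (sym (pure-> n<t))))
      ...   | inj₂ (inj₂ ft≡e) | tri> _ _ n<t = agree t (inj₁ (trans ft≡e (sym (pure-> n<t))))
      outside : ∀ t → t < m → t < n ⊎ n + suc n ≤ t → φ t ≡ 0
      outside t _ (inj₁ t<n) = φ-low t t<n
      outside t t<m (inj₂ h) = ⊥-elim (linear 2 (λ n t → n :+ (con 1 :+ n) :≤ t :⇒ t :< :m n :⇒ goal falsum) n t h t<m)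

-- Moving a pure pattern by s ≤ n while exchanging the two minor colours

module Linking (n : ℕ) (5≤n : 5 ≤ n) where
  open Circle n
  open View n
  open Route n 5≤n

  infixr 5 _+++_
  _+++_ : ∀ {f g h a b} → Reach f g a → Reach g h b → Reach f h (a + b)
  (k , k≤a , w) +++ (l , l≤b , w′) = k + l , +-mono-≤ k≤a l≤b , w ++ w′

  module _ {c d e : Colour} (dist : Distinct c d e) (good : Good (pure c d e)) where

    private
      c≢d : c ≢ d
      c≢d = proj₁ dist
      c≢e : c ≢ e
      c≢e = proj₁ (proj₂ dist)
      d≢e : d ≢ e
      d≢e = proj₂ (proj₂ dist)

    thenPaint : ∀ {f b} → Reach (pure c d e) f b → ∀ a l x → TriFree (λ t → paint f a l x t ≡ x) →
                Reach (pure c d e) (paint f a l x) (b + l)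
    thenPaint r@(_ , _ , w) a l x tri = r +++ paintWalk a l x (walk-good good w) tri

    start : Reach (pure c d e) (pure c d e) 0
    start = 0 , z≤n , done λ _ _ → refl

    pure-c : ∀ {t} → pure c d e t ≡ c → t < n
    pure-c {t} eq with pure-inv t eq
    ... | inj₁ (t<n , _)        = t<n
    ... | inj₂ (inj₁ (_ , d≡c)) = contradiction (sym d≡c) c≢d
    ... | inj₂ (inj₂ (_ , e≡c)) = contradiction (sym e≡c) c≢e

    pure-d : ∀ {t} → pure c d e t ≡ d → t ≡ n
    pure-d {t} eq with pure-inv t eq
    ... | inj₁ (_ , c≡d)        = contradiction c≡d c≢d
    ... | inj₂ (inj₁ (t≡n , _)) = t≡n
    ... | inj₂ (inj₂ (_ , e≡d)) = contradiction (sym e≡d) d≢e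

    pure-e : ∀ {t} → pure c d e t ≡ e → n < t
    pure-e {t} eq with pure-inv t eq
    ... | inj₁ (_ , c≡e)        = contradiction c≡e c≢e
    ... | inj₂ (inj₁ (_ , d≡e)) = contradiction d≡e d≢e
    ... | inj₂ (inj₂ (n<t , _)) = n<t

    -- The extra `d` at 2n lets `n` join `e`, which reduces the `e`-class to `[n, 2n)`. The
    -- `d`-class then grows from 2n through 0 over `[0, s)`, and `c` regains `s` vertices on the
    -- other side at the expense of `e`. Finally `d` takes what `e` still has beyond n + s, leaving
    -- `e` the single vertex s + n.
    link-< : ∀ {s} → s < n → ∃[ L ] Reach (pure c d e) L (2 * n) × view s L ≗ pure c e d
    link-< {s} s<n with ≤⇒∃+ s<n
    ... | l , l+1+s≡n = L₅ , (_ , ≤-trans (proj₁ (proj₂ r₅)) cost , proj₂ (proj₂ r₅)) , agree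
      where
      L₁ L₂ L₃ L₄ L₅ : ℕ → Colour
      L₁ = paint (pure c d e) (2 * n) 1 d
      L₂ = paint L₁ n 1 e
      L₃ = paint L₂ 0 s d
      L₄ = paint L₃ n s c
      L₅ = paint L₄ (suc (n + s)) l d

      tri₁ : ∀ t → t < m → L₁ t ≡ d → t ≡ n ⊎ t ≡ 2 * n
      tri₁ t _ eq with paint-inv eq
      ... | inj₁ (_ , 2n≤t , t<) = inj₂ (single 2n≤t t<)
      ... | inj₂ (eq′ , _)       = inj₁ (pure-d eq′)

      tri₂ : ∀ t → t < m → L₂ t ≡ e → n ≤ t × t < n + n
      tri₂ t t<m eq with paint-inv eq
      ... | inj₁ (_ , n≤t , t<) = n≤t , linear 2 (λ n t → con 5 :≤ n :⇒ t :< n :+ con 1 :⇒ goal (t :< n :+ n)) n t 5≤n t<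
      ... | inj₂ (eq′ , _) with paint-old d≢e eq′
      ...   | eq″ , inj₁ t<2n = <⇒≤ (pure-e eq″) , linear 2 (λ n t → t :< 2 :* n :⇒ goal (t :< n :+ n)) n t t<2n
      ...   | _   , inj₂ m≤t  = ⊥-elim (linear 2 (λ n t → t :< :m n :⇒ 2 :* n :+ con 1 :≤ t :⇒ goal falsum) n t t<m m≤t)

      L₃-d : ∀ t → t < m → L₃ t ≡ d → t < s ⊎ t ≡ 2 * n
      L₃-d t t<m eq with paint-inv eq
      ... | inj₁ (_ , _ , t<s) = inj₁ t<s
      ... | inj₂ (eq′ , _) with paint-old (d≢e ∘ sym) eq′
      ...   | eq″ , t≢n with tri₁ t t<m eq″ | t≢n
      ...     | inj₂ t≡2n | _        = inj₂ t≡2n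
      ...     | inj₁ refl | inj₁ t<t = contradiction t<t (<-irrefl refl)
      ...     | inj₁ refl | inj₂ t+1≤t = contradiction (subst (_≤ t) (+-comm t 1) t+1≤t) (<-irrefl refl)

      tri₃ : ∀ t → t < m → L₃ t ≡ d → t < s ⊎ s + suc n ≤ t
      tri₃ t t<m eq with L₃-d t t<m eq
      ... | inj₁ t<s  = inj₁ t<s
      ... | inj₂ t≡2n = inj₂ (linear 3 (λ n s t → t :≡ 2 :* n :⇒ s :< n :⇒ goal (s :+ (con 1 :+ n) :≤ t)) n s t t≡2n s<n)

      tri₄ : ∀ t → t < m → L₄ t ≡ c → s ≤ t × t < s + n
      tri₄ t t<m eq with paint-inv eq
      ... | inj₁ (_ , n≤t , t<) = ≤-trans (<⇒≤ s<n) n≤t , subst (t <_) (+-comm n s) t<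
      ... | inj₂ (eq′ , _) with paint-old (c≢d ∘ sym) eq′
      ...   | eq″ , inj₂ s≤t with pure-c (proj₁ (paint-old (c≢d ∘ sym) (proj₁ (paint-old (c≢e ∘ sym) eq″))))
      ...     | t<n = s≤t , ≤-trans t<n (m≤n+m n s)

      tri₅ : ∀ t → t < m → L₅ t ≡ d → t < s ⊎ s + suc n ≤ t
      tri₅ t t<m eq with paint-inv eq
      ... | inj₁ (_ , n+s<t , _) = inj₂ (linear 3 (λ n s t → con 1 :+ (n :+ s) :≤ t :⇒ goal (s :+ (con 1 :+ n) :≤ t)) n s t n+s<t)
      ... | inj₂ (eq′ , _) = tri₃ t t<m (proj₁ (paint-old c≢d eq′))

      r₅ : Reach (pure c d e) L₅ (0 + 1 + 1 + s + s + l)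
      r₅ = thenPaint (thenPaint (thenPaint (thenPaint (thenPaint start
             (2 * n) 1 d (triFree-pair n (2 * n) tri₁))
             n 1 e (triFree-arc n tri₂))
             0 s d (triFree-coarc s (<⇒≤ s<n) tri₃))
             n s c (triFree-arc s tri₄))
             (suc (n + s)) l d (triFree-coarc s (<⇒≤ s<n) tri₅)

      -- With l = n - 1 - s the total is n + 1 + s, which is at most 2n because s < n.
      cost : 0 + 1 + 1 + s + s + l ≤ 2 * n
      cost = linear 3 (λ n s l → l :+ (con 1 :+ s) :≡ n :⇒ s :< n :⇒ goal (con 0 :+ con 1 :+ con 1 :+ s :+ s :+ l :≤ 2 :* n))
        n s l l+1+s≡n s<n

      module At (t : ℕ) where
        L₅-window : s ≤ t → t < s + n → L₅ t ≡ c
        L₅-window s≤t t<s+n with n ≤? t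
        ... | yes n≤t = trans (paint-below (s≤s (<⇒≤ t<n+s))) (paint-in n≤t t<n+s)
          where
          t<n+s : t < n + s
          t<n+s = subst (t <_) (+-comm s n) t<s+n
        ... | no n≰t = begin
          L₅ t            ≡⟨ paint-below (m<n⇒m<1+n (≤-trans t<n (m≤m+n n s))) ⟩
          L₄ t            ≡⟨ paint-below t<n ⟩
          L₃ t            ≡⟨ paint-above s≤t ⟩
          L₂ t            ≡⟨ paint-below t<n ⟩
          L₁ t            ≡⟨ paint-below (≤-trans t<n (m≤m+n n _)) ⟩
          pure c d e t    ≡⟨ pure-< t<n ⟩
          c               ∎
          where
          open ≡-Reasoning
          t<n : t < n
          t<n = ≰⇒> n≰t

        L₅-next : t ≡ s + n → L₅ t ≡ e
        L₅-next t≡s+n = begin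
          L₅ t            ≡⟨ paint-below (linear 3 (λ n s t → t :≡ s :+ n :⇒ goal (t :< con 1 :+ (n :+ s))) n s t t≡s+n) ⟩
          L₄ t            ≡⟨ paint-above (≤-reflexive (trans (+-comm n s) (sym t≡s+n))) ⟩
          L₃ t            ≡⟨ paint-above (≤-trans (m≤m+n s n) (≤-reflexive (sym t≡s+n))) ⟩
          L₂ t            ≡⟨ L₂-e ⟩
          e               ∎
          where
          open ≡-Reasoning
          L₂-e : L₂ t ≡ e
          L₂-e with t <? n + 1
          ... | yes t<n+1 = paint-in (≤-trans (m≤n+m n s) (≤-reflexive (sym t≡s+n))) t<n+1
          ... | no  t≮n+1 = trans (paint-above (≮⇒≥ t≮n+1)) (trans
                (paint-below (linear 3 (λ n s t → t :≡ s :+ n :⇒ s :< n :⇒ goal (t :< 2 :* n)) n s t t≡s+n s<n))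
                (pure-> (subst (_≤ t) (+-comm n 1) (≮⇒≥ t≮n+1))))

        L₅-far : s + n < t → t < m → L₅ t ≡ d
        L₅-far s+n<t t<m with t <? 2 * n
        ... | yes t<2n = paint-in (subst (_< t) (+-comm s n) s+n<t)
              (linear 4 (λ n s l t → l :+ (con 1 :+ s) :≡ n :⇒ t :< 2 :* n :⇒ goal (t :< con 1 :+ (n :+ s) :+ l)) n s l t l+1+s≡n t<2n)
        ... | no t≮2n = begin
          L₅ t            ≡⟨ paint-above (linear 4 (λ n s l t → l :+ (con 1 :+ s) :≡ n :⇒ 2 :* n :≤ t :⇒
                               goal (con 1 :+ (n :+ s) :+ l :≤ t)) n s l t l+1+s≡n 2n≤t) ⟩
          L₄ t            ≡⟨ paint-above (<⇒≤ (subst (_< t) (+-comm s n) s+n<t)) ⟩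
          L₃ t            ≡⟨ paint-above (≤-trans (m≤m+n s n) (<⇒≤ s+n<t)) ⟩
          L₂ t            ≡⟨ paint-above (linear 2 (λ n t → con 5 :≤ n :⇒ 2 :* n :≤ t :⇒ goal (n :+ con 1 :≤ t)) n t 5≤n 2n≤t) ⟩
          L₁ t            ≡⟨ paint-in 2n≤t (subst (t <_) (+-comm 1 (2 * n)) t<m) ⟩
          d               ∎
          where
          open ≡-Reasoning
          2n≤t : 2 * n ≤ t
          2n≤t = ≮⇒≥ t≮2n

        L₅-near : t < s → L₅ t ≡ d
        L₅-near t<s = begin
          L₅ t            ≡⟨ paint-below (m<n⇒m<1+n (≤-trans (<-trans t<s s<n) (m≤m+n n s))) ⟩
          L₄ t            ≡⟨ paint-below (<-trans t<s s<n) ⟩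
          L₃ t            ≡⟨ paint-in z≤n t<s ⟩
          d               ∎
          where open ≡-Reasoning

      s<m : s < m
      s<m = ≤-trans s<n (≤-trans (m≤m+n n _) (n≤1+n (2 * n)))

      agree : view s L₅ ≗ pure c e d
      agree t t<m = at (shifted s<m t<m)
        where
        at : ∀ {u} → Shifted s t u → L₅ u ≡ pure c e d t
        at (straight s+t<m) with <-cmp t n
        ... | tri< t<n _ _ = trans (At.L₅-window (s + t) (m≤m+n s t) (+-monoʳ-< s t<n)) (sym (pure-< t<n))
        ... | tri≈ _ t≡n _ = trans (At.L₅-next (s + t) (cong (s +_) t≡n)) (sym (pure-≡ t≡n))
        ... | tri> _ _ n<t = trans (At.L₅-far (s + t) (+-monoʳ-< s n<t) s+t<m) (sym (pure-> n<t))
        at (wrapped u u+m≡s+t) = trans (At.L₅-near u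
            (linear 4 (λ m s t u → u :+ m :≡ s :+ t :⇒ t :< m :⇒ goal (u :< s)) m s t u u+m≡s+t t<m))
          (sym (pure-> (linear 4 (λ n s t u → u :+ :m n :≡ s :+ t :⇒ s :< n :⇒ goal (n :< t)) n s t u u+m≡s+t s<n)))

    -- For s = n the scheme of `link-<` breaks: 2n together with `[0, n)` would give `d` a run of n
    -- + 1 vertices. Here `d` grows from `n` downwards instead and stops before 0. The colour `c`
    -- survives at 0 until it can hop to `n`, by way of the pair 0 and `n`; then `d` takes 0 and `c`
    -- fills `[n, 2n)`.
    link-n : ∃[ L ] Reach (pure c d e) L (2 * n) × view n L ≗ pure c e d
    link-n with ≤⇒∃+ (≤-trans (s≤s z≤n) 5≤n)
    ... | l , l+1≡n = L₄ , (_ , ≤-trans (proj₁ (proj₂ r₄)) cost , proj₂ (proj₂ r₄)) , agree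
      where
      L₁ L₂ L₃ L₄ : ℕ → Colour
      L₁ = paint (pure c d e) 1 l d
      L₂ = paint L₁ n 1 c
      L₃ = paint L₂ 0 1 d
      L₄ = paint L₃ (suc n) l c

      tri₁ : ∀ t → t < m → L₁ t ≡ d → 1 ≤ t × t < 1 + n
      tri₁ t _ eq with paint-inv eq
      ... | inj₁ (_ , 1≤t , t<) = 1≤t , linear 3 (λ n l t → l :+ con 1 :≡ n :⇒ t :< con 1 :+ l :⇒ goal (t :< con 1 :+ n)) n l t l+1≡n t<
      ... | inj₂ (eq′ , _) with pure-d eq′
      ...   | refl = ≤-trans (s≤s z≤n) 5≤n , ≤-refl

      tri₂ : ∀ t → t < m → L₂ t ≡ c → t ≡ 0 ⊎ t ≡ n
      tri₂ t _ eq with paint-inv eq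
      ... | inj₁ (_ , n≤t , t<) = inj₂ (single n≤t t<)
      ... | inj₂ (eq′ , _) with paint-old (c≢d ∘ sym) eq′
      ...   | _   , inj₁ t<1 = inj₁ (n<1⇒n≡0 t<1)
      ...   | eq″ , inj₂ h   = ⊥-elim (linear 3 (λ n l t → l :+ con 1 :≡ n :⇒ con 1 :+ l :≤ t :⇒ t :< n :⇒ goal falsum) n l t l+1≡n h (pure-c eq″))

      tri₃ : ∀ t → t < m → L₃ t ≡ d → 0 ≤ t × t < 0 + n
      tri₃ t t<m eq with paint-inv eq
      ... | inj₁ (_ , _ , t<1) = z≤n , ≤-trans t<1 (≤-trans (s≤s z≤n) 5≤n)
      ... | inj₂ (eq′ , _) with paint-old c≢d eq′
      ...   | _   , inj₁ t<n = z≤n , t<n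
      ...   | eq″ , inj₂ h   = ⊥-elim (linear 2 (λ n t → n :+ con 1 :≤ t :⇒ t :< con 1 :+ n :⇒ goal falsum) n t h (proj₂ (tri₁ t t<m eq″)))

      tri₄ : ∀ t → t < m → L₄ t ≡ c → n ≤ t × t < n + n
      tri₄ t t<m eq with paint-inv eq
      ... | inj₁ (_ , n<t , t<) = <⇒≤ n<t ,
            linear 3 (λ n l t → l :+ con 1 :≡ n :⇒ t :< con 1 :+ n :+ l :⇒ goal (t :< n :+ n)) n l t l+1≡n t<
      ... | inj₂ (eq′ , _) with paint-old (c≢d ∘ sym) eq′
      ...   | eq″ , inj₂ 1≤t with tri₂ t t<m eq″
      ...     | inj₁ refl = contradiction 1≤t λ ()
      ...     | inj₂ refl = ≤-refl , linear 1 (λ n → con 5 :≤ n :⇒ goal (n :< n :+ n)) t 5≤n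

      r₄ : Reach (pure c d e) L₄ (0 + l + 1 + 1 + l)
      r₄ = thenPaint (thenPaint (thenPaint (thenPaint start
             1 l d (triFree-arc 1 tri₁))
             n 1 c (triFree-pair 0 n tri₂))
             0 1 d (triFree-arc 0 tri₃))
             (suc n) l c (triFree-arc n tri₄)

      cost : 0 + l + 1 + 1 + l ≤ 2 * n
      cost = linear 2 (λ n l → l :+ con 1 :≡ n :⇒ goal (con 0 :+ l :+ con 1 :+ con 1 :+ l :≤ 2 :* n)) n l l+1≡n

      module At (t : ℕ) where
        open ≡-Reasoning

        L₄-window : n ≤ t → t < n + n → L₄ t ≡ c
        L₄-window n≤t t<n+n with t <? n + 1
        ... | no t≮n+1 = paint-in (subst (_≤ t) (+-comm n 1) (≮⇒≥ t≮n+1))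
              (linear 3 (λ n l t → l :+ con 1 :≡ n :⇒ t :< n :+ n :⇒ goal (t :< con 1 :+ n :+ l)) n l t l+1≡n t<n+n)
        ... | yes t<n+1 = begin
          L₄ t            ≡⟨ paint-below (subst (t <_) (+-comm n 1) t<n+1) ⟩
          L₃ t            ≡⟨ paint-above (≤-trans (≤-trans (s≤s z≤n) 5≤n) n≤t) ⟩
          L₂ t            ≡⟨ paint-in n≤t t<n+1 ⟩
          c               ∎

        L₄-next : t ≡ n + n → L₄ t ≡ e
        L₄-next t≡n+n = begin
          L₄ t            ≡⟨ paint-above (linear 3 (λ n l t → l :+ con 1 :≡ n :⇒ t :≡ n :+ n :⇒ goal (con 1 :+ n :+ l :≤ t)) n l t l+1≡n t≡n+n) ⟩
          L₃ t            ≡⟨ paint-above (≤-trans (s≤s z≤n) n<t) ⟩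
          L₂ t            ≡⟨ paint-above (subst (_≤ t) (+-comm 1 n) n<t) ⟩
          L₁ t            ≡⟨ paint-above (linear 3 (λ n l t → l :+ con 1 :≡ n :⇒ t :≡ n :+ n :⇒ goal (con 1 :+ l :≤ t)) n l t l+1≡n t≡n+n) ⟩
          pure c d e t    ≡⟨ pure-> n<t ⟩
          e               ∎
          where
          n<t : n < t
          n<t = linear 2 (λ n t → con 5 :≤ n :⇒ t :≡ n :+ n :⇒ goal (n :< t)) n t 5≤n t≡n+n

        L₄-near : t < n → L₄ t ≡ d
        L₄-near t<n with t <? 1
        ... | yes t<1 = trans (paint-below (m<n⇒m<1+n t<n)) (paint-in z≤n t<1)
        ... | no t≮1 = begin
          L₄ t            ≡⟨ paint-below (m<n⇒m<1+n t<n) ⟩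
          L₃ t            ≡⟨ paint-above (≮⇒≥ t≮1) ⟩
          L₂ t            ≡⟨ paint-below t<n ⟩
          L₁ t            ≡⟨ paint-in (≮⇒≥ t≮1) (subst (t <_) (trans (sym l+1≡n) (+-comm l 1)) t<n) ⟩
          d               ∎

      n<m : n < m
      n<m = s≤s (m≤m+n n _)

      agree : view n L₄ ≗ pure c e d
      agree t t<m = at (shifted n<m t<m)
        where
        at : ∀ {u} → Shifted n t u → L₄ u ≡ pure c e d t
        at (straight n+t<m) with <-cmp t n
        ... | tri< t<n _ _ = trans (At.L₄-window (n + t) (m≤m+n n t) (+-monoʳ-< n t<n)) (sym (pure-< t<n))
        ... | tri≈ _ t≡n _ = trans (At.L₄-next (n + t) (cong (n +_) t≡n)) (sym (pure-≡ t≡n))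
        ... | tri> _ _ n<t = ⊥-elim (linear 2 (λ n t → n :+ t :< :m n :⇒ n :< t :⇒ goal falsum) n t n+t<m n<t)
        at (wrapped u u+m≡n+t) = trans (At.L₄-near u
            (linear 3 (λ n t u → u :+ :m n :≡ n :+ t :⇒ t :< :m n :⇒ goal (u :< n)) n t u u+m≡n+t t<m))
          (sym (pure-> (linear 3 (λ n t u → u :+ :m n :≡ n :+ t :⇒ goal (n :< t)) n t u u+m≡n+t)))

    link : ∀ {s} → s ≤ n → ∃[ L ] Reach (pure c d e) L (2 * n) × view s L ≗ pure c e d
    link {s} s≤n with s ≟ n
    ... | yes refl = link-n
    ... | no s≢n   = link-< (≤∧≢⇒< s≤n s≢n)

-- Counting by intervals and bounded search

interval : ℕ → ℕ → ℕ → ℕ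
interval a l t = ind ((a ≤? t) ×-dec (t <? a + l))

interval-in : ∀ {a l t} → a ≤ t → t < a + l → 1 ≤ interval a l t
interval-in {a} {l} {t} a≤t t<b = ≤-reflexive (sym (ind-yes ((a ≤? t) ×-dec (t <? a + l)) (a≤t , t<b)))

sum-interval : ∀ k a l → sum k (interval a l) ≤ l
sum-interval k a l = sum-support k a l (λ t _ → ind≤1 ((a ≤? t) ×-dec (t <? a + l)))
  λ { t _ (inj₁ t<a) → ind-no ((a ≤? t) ×-dec (t <? a + l)) λ { (a≤t , _) → <⇒≱ t<a a≤t }
    ; t _ (inj₂ b≤t) → ind-no ((a ≤? t) ×-dec (t <? a + l)) λ { (_ , t<b) → <⇒≱ t<b b≤t } }

sum-interval₃ : ∀ k {φ} a l a′ l′ a″ l″ →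
                (∀ t → t < k → φ t ≤ interval a l t + interval a′ l′ t + interval a″ l″ t) → sum k φ ≤ l + l′ + l″
sum-interval₃ k {φ} a l a′ l′ a″ l″ bound = begin
  sum k φ                                                            ≤⟨ sum-mono k bound ⟩
  sum k (λ t → interval a l t + interval a′ l′ t + interval a″ l″ t) ≡⟨ sum-+ k _ _ ⟩
  sum k (λ t → interval a l t + interval a′ l′ t) + sum k (interval a″ l″)
                                                                     ≡⟨ cong (_+ sum k (interval a″ l″)) (sum-+ k _ _) ⟩
  sum k (interval a l) + sum k (interval a′ l′) + sum k (interval a″ l″)
                                      ≤⟨ +-mono-≤ (+-mono-≤ (sum-interval k a l) (sum-interval k a′ l′)) (sum-interval k a″ l″) ⟩
  l + l′ + l″                                                        ∎
  where open ≤-Reasoning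

-- The range is extended at its upper end, so a witness found earlier remains the least one.
first : ∀ {P : ℕ → Set} → (∀ t → Dec (P t)) → ∀ a d →
        (∃[ t ] a ≤ t × t < a + d × P t × (∀ u → a ≤ u → u < t → ¬ P u)) ⊎ (∀ u → a ≤ u → u < a + d → ¬ P u)
first P? a zero = inj₂ λ u a≤u u<a _ → <⇒≱ u<a (≤-trans (≤-reflexive (+-identityʳ a)) a≤u)
first P? a (suc d) with first P? a d | P? (a + d)
... | inj₁ (t , a≤t , t<a+d , rest) | _ = inj₁ (t , a≤t , ≤-trans t<a+d (+-monoʳ-≤ a (n≤1+n d)) , rest)
... | inj₂ none | yes p = inj₁ (a + d , m≤m+n a d , +-monoʳ-< a ≤-refl , p , none)
... | inj₂ none | no ¬p = inj₂ none′
  where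
  none′ : ∀ u → a ≤ u → u < a + suc d → ¬ _
  none′ u a≤u u<b with u ≟ a + d
  ... | yes refl = ¬p
  ... | no u≢    = none u a≤u (≤∧≢⇒< (m<1+n⇒m≤n (subst (u <_) (+-suc a d) u<b)) u≢)

-- Turning a colour class into a full window

module Normalising (n : ℕ) (5≤n : 5 ≤ n) where
  open Circle n
  open View n
  open Route n 5≤n
  open Linking n 5≤n

  -- The bound n - a + 2 is stated as a sum, to avoid truncated subtraction.
  Normal : Colour → (ℕ → Colour) → Set
  Normal c f = ∃[ s ] s < m × ∃[ g ] ∃[ b ] Reach (view s f) g b × b + count c f ≤ 2 + n × OnWindow c g

  reach-≗ : ∀ {f f′ g b} → f ≗ f′ → Reach f′ g b → Reach f g b
  reach-≗ f≗f′ (k , k≤b , w) = k , k≤b , (done f≗f′ ++ w)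

  reach-view : ∀ {s f g b} → s < m → Reach f g b → Reach (view s f) (view s g) b
  reach-view s<m (k , k≤b , w) = k , k≤b , view-walk s<m w

  normal-view : ∀ {c f s} → s < m → Normal c (view s f) → Normal c f
  normal-view {c} {f} {s} s<m (t , t<m , g , b , r , cost , win) =
    (s + t) % m , m%n<n (s + t) m , g , b , reach-≗ (λ u u<m → sym (view-view t s f u u<m)) r ,
    subst (λ a → b + a ≤ 2 + n) (count-view c f s<m) cost , win

  0<n : 0 < n
  0<n = ≤-trans (s≤s z≤n) 5≤n

  0<m : 0 < m
  0<m = s≤s z≤n

  2<m : 2 < m
  2<m = linear 1 (λ n → con 5 :≤ n :⇒ goal (con 2 :< :m n)) n 5≤n

  -- Each vertex of the window is charged once: either it already counts towards the class or it is
  -- recoloured. The cost is therefore at most n - a, two below the allowance; the other shapes use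
  -- up that slack.
  normal-arc : ∀ {c f} → Good f → (∀ t → t < m → f t ≡ c → t < n) → Normal c f
  normal-arc {c} {f} good arc = 0 , 0<m , g , distance f g ,
    (_ , ≤-refl , (done (view-0 f) ++ recolour g c good (λ t _ → paint-or t) (triFree-arc 0 λ t t<m gt≡c → z≤n , g-arc t t<m gt≡c))) ,
    ≤-trans cost (m≤n+m n 2) , (λ t → paint-in z≤n) , λ t n≤t t<m gt≡c → <⇒≱ (g-arc t t<m gt≡c) n≤t
    where
    g : ℕ → Colour
    g = paint f 0 n c
    g-arc : ∀ t → t < m → g t ≡ c → t < n
    g-arc t t<m eq with paint-inv eq
    ... | inj₁ (_ , _ , t<n) = t<n
    ... | inj₂ (ft≡c , _)    = arc t t<m ft≡c
    cost : distance f g + count c f ≤ n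
    cost = ≤-trans (≤-reflexive (sym (sum-+ m _ _))) (sum-support m 0 n at-most-one outside)
      where
      at-most-one : ∀ t → t < m → differ (f t) (g t) + ind (f t ≟ᶜ c) ≤ 1
      at-most-one t _ with f t ≟ᶜ c
      ... | no _     = subst (_≤ 1) (sym (+-identityʳ _)) (differ≤1 (f t) (g t))
      ... | yes ft≡c = ≤-reflexive (cong (_+ 1) (differ-≡ (trans ft≡c (sym ([ (λ eq → trans eq ft≡c) , (λ eq → eq) ]′ (paint-or t))))))
      outside : ∀ t → t < m → t < 0 ⊎ 0 + n ≤ t → differ (f t) (g t) + ind (f t ≟ᶜ c) ≡ 0
      outside t t<m (inj₂ n≤t) = cong₂ _+_ (differ-≡ (sym (paint-above n≤t)))
        (ind-no (f t ≟ᶜ c) λ ft≡c → <⇒≱ (arc t t<m ft≡c) n≤t)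

  -- Both exceptional shapes keep n + 1 and give up 0, so their window is `[2, n + 2)`.
  onWindow-view-2 : ∀ {c f} → (∀ t → 2 ≤ t → t < 2 + n → f t ≡ c) →
                    (∀ t → t < m → f t ≡ c → 2 ≤ t × t < 2 + n) → OnWindow c (view 2 f)
  onWindow-view-2 {c} {f} in′ out = low , high
    where
    low : ∀ t → t < n → view 2 f t ≡ c
    low t t<n = trans (cong f (m<n⇒m%n≡m
        (linear 2 (λ n t → con 5 :≤ n :⇒ t :< n :⇒ goal (con 2 :+ t :< :m n)) n t 5≤n t<n)))
      (in′ (2 + t) (m≤m+n 2 t) (+-monoʳ-< 2 t<n))
    high : ∀ t → n ≤ t → t < m → view 2 f t ≢ c
    high t n≤t t<m eq = at (shifted 2<m t<m) (out _ (m%n<n (2 + t) m) eq)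
      where
      at : ∀ {u} → Shifted 2 t u → ¬ (2 ≤ u × u < 2 + n)
      at (straight _)    (_ , t<n) = linear 2 (λ n t → con 2 :+ t :< con 2 :+ n :⇒ n :≤ t :⇒ goal falsum) n t t<n n≤t
      at (wrapped u u≡) (2≤u , _) = linear 3 (λ m t u → u :+ m :≡ con 2 :+ t :⇒ t :< m :⇒ con 2 :≤ u :⇒ goal falsum) m t u u≡ t<m 2≤u

  -- Since 0 is the smallest position, a new triple must have it as first point, and then the first
  -- gap equals `j`.
  triFree-insert-0 : ∀ {f y} → Good f →
    (∀ {j k} q r → j + q ≡ k → k + r ≡ m → 1 ≤ j → 1 ≤ q → k < m → f j ≡ y → f k ≡ y → Backward j ⊎ Backward q ⊎ Backward r) →
    TriFree (λ t → paint f 0 1 y t ≡ y)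
  triFree-insert-0 {f} {y} good new {zero} p q r refl jq kr 1≤p 1≤q k<m _ yj yk =
    new q r jq kr 1≤p 1≤q k<m (trans (sym (paint-above 1≤p)) yj) (trans (sym (paint-above 1≤k)) yk)
    where
    1≤k = ≤-trans 1≤p (≤-trans (m≤m+n p q) (≤-reflexive jq))
  triFree-insert-0 {f} {y} good new {suc i} p q r ip jq kr 1≤p 1≤q k<m yi yj yk =
    good y p q r ip jq kr 1≤p 1≤q k<m (old z<s yi) (old 1≤j yj) (old (≤-trans 1≤j (≤-trans (m≤m+n _ q) (≤-reflexive jq))) yk)
    where
    z<s : 1 ≤ suc i
    z<s = s≤s z≤n
    1≤j = ≤-trans (≤-trans z<s (m≤m+n (suc i) p)) (≤-reflexive ip)
    old : ∀ {t} → 1 ≤ t → paint f 0 1 y t ≡ y → f t ≡ y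
    old 1≤t eq = trans (sym (paint-above 1≤t)) eq

  noTriangle : ∀ {f x i j k} p q r → Good f → i + p ≡ j → j + q ≡ k → k + r ≡ i + m → 1 ≤ p → 1 ≤ q → k < m →
               Forward p → Forward q → Forward r → f i ≡ x → f j ≡ x → f k ≢ x
  noTriangle p q r good ip jq kr 1≤p 1≤q k<m fp fq fr xi xj xk with good _ p q r ip jq kr 1≤p 1≤q k<m xi xj xk
  ... | inj₁ b        = forward⇒¬backward fp b
  ... | inj₂ (inj₁ b) = forward⇒¬backward fq b
  ... | inj₂ (inj₂ b) = forward⇒¬backward fr b

  -- Filling `[2, n)` keeps the class triangle-free: 0 and n + 1 close with gap n, and without 0 the
  -- class lies in an arc of `n` vertices. After that, 1 is the only vertex strictly between 0 and
  -- `n` outside the class. So a colour `y` different from `c` and `f 1` has no vertex there, nor at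
  -- n + 1, and every gap from 0 to a `y`-vertex is backward; hence 0 may become `y`. Moving 0 out
  -- and `n` in are the two extra recolourings.
  normal-spread : ∀ {c f} → Good f → f 0 ≡ c → f (suc n) ≡ c →
                  (∀ t → t < m → f t ≡ c → t ≡ 0 ⊎ (2 ≤ t × t < n) ⊎ t ≡ suc n) → Normal c f
  normal-spread {c} {f} good f0≡c fn+1≡c shape with third c (f 1) | ≤⇒∃+ {2} (≤-trans (s≤s (s≤s z≤n)) 5≤n)
  ... | y , y≢c , y≢f1 | l , l+2≡n =
    2 , 2<m , view 2 f₃ , distance f f₁ + (1 + 1) ,
    reach-view 2<m ((_ , ≤-refl , w₁) +++ r₂ +++ r₃) , cost , onWindow-view-2 f₃-in f₃-out
    where
    f₁ f₂ f₃ : ℕ → Colour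
    f₁ = paint f 2 l c
    f₂ = paint f₁ 0 1 y
    f₃ = paint f₂ n 1 c
    2+l≡n : 2 + l ≡ n
    2+l≡n = trans (+-comm 2 l) l+2≡n
    f₁-c : ∀ t → t < m → f₁ t ≡ c → t ≡ 0 ⊎ (2 ≤ t × t < n) ⊎ t ≡ suc n
    f₁-c t t<m eq with paint-inv eq
    ... | inj₁ (_ , 2≤t , t<) = inj₂ (inj₁ (2≤t , subst (t <_) 2+l≡n t<))
    ... | inj₂ (ft≡c , _)     = shape t t<m ft≡c
    tri₁ : TriFree (λ t → f₁ t ≡ c)
    tri₁ = triFree-⊆ f₁-c tri
      where
      tri : TriFree (λ t → t ≡ 0 ⊎ (2 ≤ t × t < n) ⊎ t ≡ suc n)
      tri {k = k} p q r _ _ kr _ _ _ (inj₁ refl) _ (inj₂ (inj₂ k≡)) =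
        inj₂ (inj₂ (inj₁ (linear 3 (λ n k r → k :+ r :≡ :m n :⇒ k :≡ con 1 :+ n :⇒ goal (r :≡ n)) n k r kr k≡)))
      tri {k = k} p q r _ _ kr _ _ _ (inj₁ refl) _ (inj₂ (inj₁ (_ , k<n))) =
        inj₂ (inj₂ (inj₂ (linear 3 (λ n k r → k :+ r :≡ :m n :⇒ k :< n :⇒ goal (con 2 :+ n :≤ r)) n k r kr k<n)))
      tri {i} {j} {k} p q r ip jq kr 1≤p _ _ _ _ (inj₁ refl) =
        ⊥-elim (linear 4 (λ i p j q → i :+ p :≡ j :⇒ j :+ q :≡ con 0 :⇒ con 1 :≤ p :⇒ goal falsum) i p j q ip jq 1≤p)
      tri {i} {j} {k} p q r ip jq kr 1≤p _ _ (inj₂ (inj₁ (2≤i , _))) _ (inj₂ kin) =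
        inj₂ (inj₂ (inj₂ (linear 4 (λ n i k r → k :+ r :≡ i :+ :m n :⇒ con 2 :≤ i :⇒ k :≤ con 1 :+ n :⇒ goal (con 2 :+ n :≤ r))
          n i k r kr 2≤i (k≤ kin))))
        where
        k≤ : ∀ {k} → (2 ≤ k × k < n) ⊎ k ≡ suc n → k ≤ suc n
        k≤ (inj₁ (_ , k<n)) = ≤-trans (<⇒≤ k<n) (n≤1+n n)
        k≤ (inj₂ refl)      = ≤-refl
      tri {i} {j} {k} p q r ip jq kr 1≤p _ _ (inj₂ (inj₂ i≡)) _ (inj₂ kin) = ⊥-elim (k≤ kin)
        where
        k≤ : (2 ≤ k × k < n) ⊎ k ≡ suc n → ⊥
        k≤ (inj₁ (_ , k<n)) = linear 6 (λ n i p j q k → i :+ p :≡ j :⇒ j :+ q :≡ k :⇒ con 1 :≤ p :⇒ i :≡ con 1 :+ n :⇒ k :< n :⇒ goal falsum)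
          n i p j q k ip jq 1≤p i≡ k<n
        k≤ (inj₂ k≡) = linear 6 (λ n i p j q k → i :+ p :≡ j :⇒ j :+ q :≡ k :⇒ con 1 :≤ p :⇒ i :≡ con 1 :+ n :⇒ k :≡ con 1 :+ n :⇒ goal falsum)
          n i p j q k ip jq 1≤p i≡ k≡
    w₁ : Walk f f₁ (distance f f₁)
    w₁ = recolour f₁ c good (λ t _ → paint-or t) tri₁
    good₁ : Good f₁
    good₁ = walk-good good w₁
    outer : ∀ t → 1 ≤ t → t < m → f₁ t ≡ y → n ≤ t × t ≢ suc n
    outer t 1≤t t<m eq with paint-old (y≢c ∘ sym) eq
    ... | ft≡y , inj₂ n≤t = subst (_≤ t) 2+l≡n n≤t , λ { refl → y≢c (trans (sym ft≡y) fn+1≡c) }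
    ... | ft≡y , inj₁ t<2 = contradiction (trans (sym ft≡y) (cong f (≤-antisym (m<1+n⇒m≤n t<2) 1≤t))) y≢f1
    r₂ : Reach f₁ f₂ 1
    r₂ = paintWalk 0 1 y good₁ (triFree-insert-0 good₁ λ {j} {k} q r jq kr 1≤j 1≤q k<m yj yk →
      inj₁ (backward (outer j 1≤j (≤-<-trans (≤-trans (m≤m+n j q) (≤-reflexive jq)) k<m) yj)))
      where
      backward : ∀ {j} → n ≤ j × j ≢ suc n → Backward j
      backward {j} (n≤j , j≢n+1) with j ≟ n
      ... | yes j≡n = inj₁ j≡n
      ... | no j≢n  = inj₂ (≤∧≢⇒< (≤∧≢⇒< n≤j (j≢n ∘ sym)) (j≢n+1 ∘ sym))
    f₃-out : ∀ t → t < m → f₃ t ≡ c → 2 ≤ t × t < 2 + n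
    f₃-out t t<m eq with paint-inv eq
    ... | inj₁ (_ , n≤t , t<n+1) = ≤-trans (≤-trans (s≤s (s≤s z≤n)) 5≤n) n≤t ,
          linear 2 (λ n t → t :< n :+ con 1 :⇒ goal (t :< con 2 :+ n)) n t t<n+1
    ... | inj₂ (eq′ , _) with paint-old y≢c eq′
    ...   | eq″ , inj₂ 1≤t with f₁-c t t<m eq″
    ...     | inj₁ refl              = contradiction 1≤t λ ()
    ...     | inj₂ (inj₁ (2≤t , t<n)) = 2≤t , ≤-trans t<n (m≤n+m n 2)
    ...     | inj₂ (inj₂ refl)       = s≤s 0<n , ≤-refl
    f₃-in : ∀ t → 2 ≤ t → t < 2 + n → f₃ t ≡ c
    f₃-in t 2≤t t<2+n with <-cmp t n
    ... | tri≈ _ refl _ = paint-in ≤-refl (≤-reflexive (+-comm 1 n))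
    ... | tri< t<n _ _ = trans (paint-below t<n) (trans (paint-above (<⇒≤ 2≤t)) (paint-in 2≤t (subst (t <_) (sym 2+l≡n) t<n)))
    ... | tri> _ _ n<t = trans (paint-above (subst (_≤ t) (+-comm 1 n) n<t)) (trans (paint-above (<⇒≤ 2≤t))
            (trans (paint-above (subst (_≤ t) (sym 2+l≡n) (<⇒≤ n<t))) (trans (cong f (≤-antisym (m<1+n⇒m≤n t<2+n) n<t)) fn+1≡c)))
    r₃ : Reach f₂ f₃ 1
    r₃ = paintWalk n 1 c (walk-good good₁ (proj₂ (proj₂ r₂))) (triFree-arc 2 f₃-out)
    fill : distance f f₁ + count c f ≤ l + 1 + 1
    fill = ≤-trans (≤-reflexive (sym (sum-+ m _ _))) (sum-interval₃ m 2 l 0 1 (suc n) 1 bound)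
      where
      φ : ℕ → ℕ
      φ t = differ (f t) (f₁ t) + ind (f t ≟ᶜ c)
      at-most-one : ∀ t → φ t ≤ 1
      at-most-one t with f t ≟ᶜ c
      ... | no _     = subst (_≤ 1) (sym (+-identityʳ _)) (differ≤1 (f t) (f₁ t))
      ... | yes ft≡c = ≤-reflexive (cong (_+ 1) (differ-≡ (trans ft≡c (sym ([ (λ eq → trans eq ft≡c) , (λ eq → eq) ]′ (paint-or t))))))
      bound : ∀ t → t < m → φ t ≤ interval 2 l t + interval 0 1 t + interval (suc n) 1 t
      bound t t<m with paint-inv {f} {2} {l} {c} {t} refl
      ... | inj₁ (_ , 2≤t , t<) = ≤-trans (at-most-one t) (≤-trans (interval-in 2≤t t<) (≤-trans (m≤m+n _ _) (m≤m+n _ _)))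
      ... | inj₂ (ft≡ , out) with f t ≟ᶜ c
      ...   | no ft≢c = ≤-trans (≤-reflexive (trans (+-identityʳ _) (differ-≡ ft≡))) z≤n
      ...   | yes ft≡c with shape t t<m ft≡c
      ...     | inj₁ refl = ≤-trans (≤-reflexive (cong (_+ 1) (differ-≡ ft≡)))
                (≤-trans (interval-in {0} {1} z≤n (s≤s z≤n)) (≤-trans (m≤n+m _ (interval 2 l 0)) (m≤m+n _ _)))
      ...     | inj₂ (inj₂ refl) = ≤-trans (≤-reflexive (cong (_+ 1) (differ-≡ ft≡)))
                (≤-trans (interval-in {suc n} {1} ≤-refl (≤-reflexive (+-comm 1 (suc n)))) (m≤n+m _ _))
      ...     | inj₂ (inj₁ (2≤t , t<n)) = ≤-trans (≤-reflexive (cong (_+ 1) (differ-≡ ft≡)))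
                (≤-trans (interval-in 2≤t (subst (t <_) (sym 2+l≡n) t<n)) (≤-trans (m≤m+n _ _) (m≤m+n _ _)))
    cost : distance f f₁ + (1 + 1) + count c f ≤ 2 + n
    cost = linear 4 (λ n l x y → l :+ con 2 :≡ n :⇒ x :+ y :≤ l :+ con 1 :+ con 1 :⇒ goal (x :+ (con 1 :+ con 1) :+ y :≤ con 2 :+ n))
      n l (distance f f₁) (count c f) l+2≡n fill

  -- If 0 fitted neither into the class of 1 nor into the third class, then 1, 2,
  -- 3 and n + 2 would share a colour, but 2, 3, n + 2 span a directed triangle.
  escape : ∀ {c f} → Good f → f 0 ≡ c → f n ≡ c → f (suc n) ≡ c →
           (∀ t → t < m → f t ≡ c → t ≡ 0 ⊎ t ≡ n ⊎ t ≡ suc n) →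
           ∃[ y ] y ≢ c × TriFree (λ t → paint f 0 1 y t ≡ y)
  escape {c} {f} good f0≡c fn≡c fn+1≡c shape
    with third c (f 1) | ≤⇒∃+ 0<n | ≤⇒∃+ {4} (≤-trans (n≤1+n 4) 5≤n)
  ... | e , e≢c , e≢d | n₁ , n₁+1≡n | n₄ , n₄+4≡n = choose
    where
    d : Colour
    d = f 1
    not-c : ∀ {t} → t < m → t ≢ 0 → t ≢ n → t ≢ suc n → f t ≢ c
    not-c t<m t≢0 t≢n t≢n+1 ft≡c with shape _ t<m ft≡c
    ... | inj₁ t≡0          = t≢0 t≡0
    ... | inj₂ (inj₁ t≡n)   = t≢n t≡n
    ... | inj₂ (inj₂ t≡n+1) = t≢n+1 t≡n+1
    d≢c : d ≢ c
    d≢c = not-c (linear 1 (λ n → con 5 :≤ n :⇒ goal (con 1 :< :m n)) n 5≤n) (λ ())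
      (<⇒≢ (≤-trans (s≤s (s≤s z≤n)) 5≤n)) (<⇒≢ (s≤s 0<n))
    dist : Distinct c d e
    dist = d≢c ∘ sym , e≢c ∘ sym , e≢d ∘ sym
    sides : ∀ {t y} → y ≢ c → f t ≡ y → t < n ⊎ 2 + n ≤ t
    sides {t} y≢c ft≡y with <-cmp t n
    ... | tri< t<n _ _  = inj₁ t<n
    ... | tri≈ _ refl _ = contradiction (trans (sym ft≡y) fn≡c) y≢c
    ... | tri> _ _ n<t  = inj₂ (≤∧≢⇒< n<t λ { refl → y≢c (trans (sym ft≡y) fn+1≡c) })

    insertable : ∀ y → y ≢ c →
                 (∀ {j k} q r → j + q ≡ k → k + r ≡ m → 1 ≤ j → j < n → 2 + n ≤ k → k < m →
                  f j ≡ y → f k ≡ y → Backward j ⊎ Backward q ⊎ Backward r) →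
                 TriFree (λ t → paint f 0 1 y t ≡ y)
    insertable y y≢c across = triFree-insert-0 good λ {j} {k} q r jq kr 1≤j 1≤q k<m yj yk →
      new q r jq kr 1≤j k<m yj yk (sides y≢c yj) (sides y≢c yk)
      where
      new : ∀ {j k} q r → j + q ≡ k → k + r ≡ m → 1 ≤ j → k < m → f j ≡ y → f k ≡ y →
            j < n ⊎ 2 + n ≤ j → k < n ⊎ 2 + n ≤ k → Backward j ⊎ Backward q ⊎ Backward r
      new q r jq kr 1≤j k<m yj yk (inj₂ n+2≤j) _ = inj₁ (inj₂ n+2≤j)
      new {k = k} q r jq kr 1≤j k<m yj yk (inj₁ _) (inj₁ k<n) =
        inj₂ (inj₂ (inj₂ (linear 3 (λ n k r → k :+ r :≡ :m n :⇒ k :< n :⇒ goal (con 2 :+ n :≤ r)) n k r kr k<n)))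
      new q r jq kr 1≤j k<m yj yk (inj₁ j<n) (inj₂ n+2≤k) = across q r jq kr 1≤j j<n n+2≤k k<m yj yk

    -- The vertex 1, coloured `d`, is a proxy for 0. In the triple 1, j, k the gaps j - 1 and r + 1
    -- are forward, the latter because k is at least n + 3; so the common gap `q` is backward. For j
    -- = 1, `q` itself is at least n + 2.
    use-d : f (2 + n) ≢ d → TriFree (λ t → paint f 0 1 d t ≡ d)
    use-d fn+2≢d = insertable d d≢c across
      where
      far : ∀ {k} → 2 + n ≤ k → f k ≡ d → 3 + n ≤ k
      far n+2≤k fk≡d = ≤∧≢⇒< n+2≤k λ { refl → fn+2≢d fk≡d }
      across : ∀ {j k} q r → j + q ≡ k → k + r ≡ m → 1 ≤ j → j < n → 2 + n ≤ k → k < m →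
               f j ≡ d → f k ≡ d → Backward j ⊎ Backward q ⊎ Backward r
      across {suc zero} {k} q r jq kr _ _ n+2≤k k<m dj dk =
        inj₂ (inj₁ (inj₂ (linear 3 (λ n k q → con 1 :+ q :≡ k :⇒ con 3 :+ n :≤ k :⇒ goal (con 2 :+ n :≤ q))
          n k q jq (far n+2≤k dk))))
      across {suc (suc j)} {k} q r jq kr _ j<n n+2≤k k<m dj dk
        with good d (suc j) q (suc r) refl jq (trans (+-suc k r) (cong suc kr)) (s≤s z≤n)
               (linear 4 (λ n j q k → con 2 :+ j :+ q :≡ k :⇒ con 2 :+ j :< n :⇒ con 2 :+ n :≤ k :⇒ goal (con 1 :≤ q))
                 n j q k jq j<n n+2≤k) k<m refl dj dk
      ... | inj₂ (inj₁ bq)         = inj₂ (inj₁ bq)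
      ... | inj₁ (inj₁ 1+j≡n)      = contradiction (subst (suc (suc j) <_) (sym 1+j≡n) j<n) (<-asym ≤-refl)
      ... | inj₁ (inj₂ n+2≤1+j)    = ⊥-elim (linear 2 (λ n j → con 2 :+ n :≤ con 1 :+ j :⇒ con 2 :+ j :< n :⇒ goal falsum) n j n+2≤1+j j<n)
      ... | inj₂ (inj₂ (inj₁ 1+r≡n)) = ⊥-elim (linear 3 (λ n k r → k :+ r :≡ :m n :⇒ con 1 :+ r :≡ n :⇒ con 3 :+ n :≤ k :⇒ goal falsum)
                                         n k r kr 1+r≡n (far n+2≤k dk))
      ... | inj₂ (inj₂ (inj₂ n+2≤1+r)) = ⊥-elim (linear 3 (λ n k r → k :+ r :≡ :m n :⇒ con 2 :+ n :≤ con 1 :+ r :⇒ con 2 :+ n :≤ k :⇒ goal falsum)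
                                         n k r kr n+2≤1+r n+2≤k)

    -- Here 2n is the proxy for 0 from the other side. In the triple j, k, 2n the gaps 2n - k and j
    -- + 1 are forward, the latter because j ≤ n - 2; so `q` is backward again.
    use-e : f (2 * n) ≡ e → f n₁ ≢ e → TriFree (λ t → paint f 0 1 e t ≡ e)
    use-e f2n≡e fn₁≢e = insertable e e≢c across
      where
      near : ∀ {j} → j < n → f j ≡ e → 2 + j ≤ n
      near {j} j<n fj≡e = ≤∧≢⇒< j<n λ 1+j≡n → fn₁≢e (trans (cong f (linear 3 (λ n n₁ j → n₁ :+ con 1 :≡ n :⇒ con 1 :+ j :≡ n :⇒ goal (n₁ :≡ j))
        n n₁ j n₁+1≡n 1+j≡n)) fj≡e)
      across : ∀ {j k} q r → j + q ≡ k → k + r ≡ m → 1 ≤ j → j < n → 2 + n ≤ k → k < m →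
               f j ≡ e → f k ≡ e → Backward j ⊎ Backward q ⊎ Backward r
      across {j} {k} q r jq kr 1≤j j<n n+2≤k k<m ej ek with k ≟ 2 * n
      ... | yes k≡2n = inj₂ (inj₁ (inj₂ (linear 4 (λ n j q k → j :+ q :≡ k :⇒ k :≡ 2 :* n :⇒ con 2 :+ j :≤ n :⇒ goal (con 2 :+ n :≤ q))
                         n j q k jq k≡2n (near j<n ej))))
      ... | no k≢2n with ≤⇒∃+ (≤∧≢⇒< (m<1+n⇒m≤n k<m) k≢2n)
      ...   | q′ , q′+1+k≡2n
        with good e q (suc q′) (suc j) jq
               (linear 3 (λ n k q′ → q′ :+ (con 1 :+ k) :≡ 2 :* n :⇒ goal (k :+ (con 1 :+ q′) :≡ 2 :* n)) n k q′ q′+1+k≡2n)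
               (linear 2 (λ n j → goal (2 :* n :+ (con 1 :+ j) :≡ j :+ :m n)) n j)
               (linear 4 (λ n j q k → j :+ q :≡ k :⇒ j :< n :⇒ con 2 :+ n :≤ k :⇒ goal (con 1 :≤ q)) n j q k jq j<n n+2≤k)
               (s≤s z≤n) 2n<m ej ek f2n≡e
      ...     | inj₁ bq = inj₂ (inj₁ bq)
      ...     | inj₂ (inj₁ b) = ⊥-elim (absurd′ b)
        where
        absurd′ : Backward (suc q′) → ⊥
        absurd′ (inj₁ h) = linear 3 (λ n k q′ → q′ :+ (con 1 :+ k) :≡ 2 :* n :⇒ con 2 :+ n :≤ k :⇒ con 1 :+ q′ :≡ n :⇒ goal falsum)
          n k q′ q′+1+k≡2n n+2≤k h
        absurd′ (inj₂ h) = linear 3 (λ n k q′ → q′ :+ (con 1 :+ k) :≡ 2 :* n :⇒ con 2 :+ n :≤ k :⇒ con 2 :+ n :≤ con 1 :+ q′ :⇒ goal falsum)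
          n k q′ q′+1+k≡2n n+2≤k h
      ...     | inj₂ (inj₂ (inj₁ 1+j≡n)) = contradiction 1+j≡n (<⇒≢ (near j<n ej))
      ...     | inj₂ (inj₂ (inj₂ h))     = contradiction h (<⇒≱ (m<n⇒m<1+n (s≤s j<n)))

    -- Otherwise 2n would be `d`, and 1, n + 2, 2n has the forward gaps n + 1, n - 2, 2.
    f2n≡e : f (2 + n) ≡ d → f (2 * n) ≡ e
    f2n≡e fn+2≡d with exhaustive dist (f (2 * n))
    ... | inj₂ (inj₂ eq) = eq
    ... | inj₁ eq = contradiction eq (not-c 2n<m
            (λ h → linear 1 (λ n → con 5 :≤ n :⇒ 2 :* n :≡ con 0 :⇒ goal falsum) n 5≤n h)
            (λ h → linear 1 (λ n → con 5 :≤ n :⇒ 2 :* n :≡ n :⇒ goal falsum) n 5≤n h)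
            (λ h → linear 1 (λ n → con 5 :≤ n :⇒ 2 :* n :≡ con 1 :+ n :⇒ goal falsum) n 5≤n h))
    ... | inj₂ (inj₁ eq) = contradiction eq (noTriangle (suc n) (n₄ + 2) 2 good refl
            (linear 2 (λ n n₄ → n₄ :+ con 4 :≡ n :⇒ goal (con 2 :+ n :+ (n₄ :+ con 2) :≡ 2 :* n)) n n₄ n₄+4≡n)
            (linear 1 (λ n → goal (2 :* n :+ con 2 :≡ con 1 :+ :m n)) n)
            (s≤s z≤n) (≤-trans (s≤s z≤n) (m≤n+m 2 n₄)) 2n<m
            (inj₂ refl) (inj₁ (linear 2 (λ n n₄ → n₄ :+ con 4 :≡ n :⇒ goal (n₄ :+ con 2 :< n)) n n₄ n₄+4≡n))
            (inj₁ (≤-trans (s≤s (s≤s (s≤s z≤n))) 5≤n)) refl fn+2≡d)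

    -- Colour `e` is excluded by the triangle z, n - 1, 2n, whose gaps are p, n + 1 and z + 1.
    inner : ∀ z p → 2 ≤ z → 1 ≤ p → z + p ≡ n₁ → f (2 * n) ≡ e → f n₁ ≡ e → f z ≡ d
    inner z p 2≤z 1≤p z+p≡n₁ f2n≡e fn₁≡e with exhaustive dist (f z)
    ... | inj₂ (inj₁ eq) = eq
    ... | inj₁ eq = contradiction eq (not-c
            (linear 4 (λ n n₁ z p → n₁ :+ con 1 :≡ n :⇒ z :+ p :≡ n₁ :⇒ goal (z :< :m n)) n n₁ z p n₁+1≡n z+p≡n₁)
            (λ { refl → contradiction 2≤z λ () })
            (<⇒≢ z<n) (<⇒≢ (m<n⇒m<1+n z<n)))
      where
      z<n : z < n
      z<n = linear 4 (λ n n₁ z p → n₁ :+ con 1 :≡ n :⇒ z :+ p :≡ n₁ :⇒ goal (z :< n)) n n₁ z p n₁+1≡n z+p≡n₁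
    ... | inj₂ (inj₂ eq) = contradiction f2n≡e (noTriangle p (suc n) (suc z) good z+p≡n₁
            (linear 2 (λ n n₁ → n₁ :+ con 1 :≡ n :⇒ goal (n₁ :+ (con 1 :+ n) :≡ 2 :* n)) n n₁ n₁+1≡n)
            (linear 2 (λ n z → goal (2 :* n :+ (con 1 :+ z) :≡ z :+ :m n)) n z)
            1≤p (s≤s z≤n) 2n<m
            (inj₁ (linear 4 (λ n n₁ z p → n₁ :+ con 1 :≡ n :⇒ z :+ p :≡ n₁ :⇒ goal (p :< n)) n n₁ z p n₁+1≡n z+p≡n₁))
            (inj₂ refl)
            (inj₁ (linear 4 (λ n n₁ z p → n₁ :+ con 1 :≡ n :⇒ z :+ p :≡ n₁ :⇒ con 1 :≤ p :⇒ goal (con 1 :+ z :< n)) n n₁ z p n₁+1≡n z+p≡n₁ 1≤p))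
            eq fn₁≡e)

    choose : ∃[ y ] y ≢ c × TriFree (λ t → paint f 0 1 y t ≡ y)
    choose with f (2 + n) ≟ᶜ d | f n₁ ≟ᶜ e
    ... | no fn+2≢d  | _        = d , d≢c , use-d fn+2≢d
    ... | yes fn+2≡d | no fn₁≢e = e , e≢c , use-e (f2n≡e fn+2≡d) fn₁≢e
    -- The triangle 2, 3, n + 2 has gaps 1, n - 1, n + 1. Applying `inner` to 3 needs 3 < n - 1,
    -- which is where n ≥ 5 enters.
    ... | yes fn+2≡d | yes fn₁≡e = contradiction fn+2≡d (noTriangle 1 n₁ (suc n) good refl
            (linear 2 (λ n n₁ → n₁ :+ con 1 :≡ n :⇒ goal (con 3 :+ n₁ :≡ con 2 :+ n)) n n₁ n₁+1≡n)
            (linear 1 (λ n → goal (con 2 :+ n :+ (con 1 :+ n) :≡ con 2 :+ :m n)) n)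
            ≤-refl
            (linear 2 (λ n n₁ → n₁ :+ con 1 :≡ n :⇒ con 5 :≤ n :⇒ goal (con 1 :≤ n₁)) n n₁ n₁+1≡n 5≤n)
            (linear 1 (λ n → con 5 :≤ n :⇒ goal (con 2 :+ n :< :m n)) n 5≤n)
            (inj₁ (≤-trans (s≤s (s≤s z≤n)) 5≤n)) (inj₁ (≤-reflexive (trans (+-comm 1 n₁) n₁+1≡n))) (inj₂ refl)
            (inner 2 (n₄ + 1) ≤-refl (m≤n+m 1 n₄) (n₁≡ 2 1 refl) (f2n≡e fn+2≡d) fn₁≡e)
            (inner 3 n₄ (s≤s (s≤s z≤n)) (linear 2 (λ n n₄ → n₄ :+ con 4 :≡ n :⇒ con 5 :≤ n :⇒ goal (con 1 :≤ n₄)) n n₄ n₄+4≡n 5≤n)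
              (linear 3 (λ n n₁ n₄ → n₁ :+ con 1 :≡ n :⇒ n₄ :+ con 4 :≡ n :⇒ goal (con 3 :+ n₄ :≡ n₁)) n n₁ n₄ n₁+1≡n n₄+4≡n)
              (f2n≡e fn+2≡d) fn₁≡e))
      where
      n₁≡ : ∀ a b → a + b ≡ 3 → a + (n₄ + b) ≡ n₁
      n₁≡ a b = linear 5 (λ n n₁ n₄ a b → n₁ :+ con 1 :≡ n :⇒ n₄ :+ con 4 :≡ n :⇒ a :+ b :≡ con 3 :⇒ goal (a :+ (n₄ :+ b) :≡ n₁))
        n n₁ n₄ a b n₁+1≡n n₄+4≡n

  -- The triple 0, t, n has gaps t, n - t and n + 1, all forward.
  inside : ∀ {c f} → Good f → f 0 ≡ c → f n ≡ c → ∀ t → 1 ≤ t → t < n → f t ≢ c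
  inside good f0≡c fn≡c t 1≤t t<n ft≡c with ≤⇒∃+ (<⇒≤ t<n)
  ... | q , q+t≡n = noTriangle t q (suc n) good refl (trans (+-comm t q) q+t≡n)
    (linear 1 (λ n → goal (n :+ (con 1 :+ n) :≡ :m n)) n) 1≤t
    (linear 3 (λ n t q → q :+ t :≡ n :⇒ t :< n :⇒ goal (con 1 :≤ q)) n t q q+t≡n t<n)
    (s≤s (m≤m+n n _)) (inj₁ t<n)
    (inj₁ (linear 3 (λ n t q → q :+ t :≡ n :⇒ con 1 :≤ t :⇒ goal (q :< n)) n t q q+t≡n 1≤t))
    (inj₂ refl) f0≡c ft≡c fn≡c

  -- The triple 0, n + 1, t has gaps n + 1, t - n - 1 and m - t, all forward.
  beyond : ∀ {c f} → Good f → f 0 ≡ c → f (suc n) ≡ c → ∀ t → 2 + n ≤ t → t < m → f t ≢ c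
  beyond good f0≡c fn+1≡c t n+2≤t t<m with ≤⇒∃+ (≤-trans (n≤1+n _) n+2≤t) | ≤⇒∃+ (<⇒≤ t<m)
  ... | q , q+n+1≡t | r , r+t≡m = noTriangle (suc n) q r good refl (trans (+-comm (suc n) q) q+n+1≡t) (trans (+-comm t r) r+t≡m)
    (s≤s z≤n)
    (linear 3 (λ n t q → q :+ (con 1 :+ n) :≡ t :⇒ con 2 :+ n :≤ t :⇒ goal (con 1 :≤ q)) n t q q+n+1≡t n+2≤t)
    t<m (inj₂ refl)
    (inj₁ (linear 3 (λ n t q → q :+ (con 1 :+ n) :≡ t :⇒ t :< :m n :⇒ goal (q :< n)) n t q q+n+1≡t t<m))
    (inj₁ (linear 3 (λ n t r → r :+ t :≡ :m n :⇒ con 2 :+ n :≤ t :⇒ goal (r :< n)) n t r r+t≡m n+2≤t))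
    f0≡c fn+1≡c

  -- By `inside` and `beyond` the class has just these three vertices, so the allowance is n - 1:
  -- one step to move 0 out and n - 2 to fill `[2, n)`.
  normal-antipodal : ∀ {c f} → Good f → f 0 ≡ c → f n ≡ c → f (suc n) ≡ c → Normal c f
  normal-antipodal {c} {f} good f0≡c fn≡c fn+1≡c = result (escape good f0≡c fn≡c fn+1≡c shape)
    where
    shape : ∀ t → t < m → f t ≡ c → t ≡ 0 ⊎ t ≡ n ⊎ t ≡ suc n
    shape zero    _   _    = inj₁ refl
    shape (suc t) t<m ft≡c with <-cmp (suc t) n | suc t ≟ suc n
    ... | tri≈ _ t≡n _ | _         = inj₂ (inj₁ t≡n)
    ... | _            | yes t≡n+1 = inj₂ (inj₂ t≡n+1)
    ... | tri< t<n _ _ | no _      = contradiction ft≡c (inside good f0≡c fn≡c (suc t) (s≤s z≤n) t<n)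
    ... | tri> _ _ n<t | no t≢n+1  = contradiction ft≡c (beyond good f0≡c fn+1≡c (suc t) (≤∧≢⇒< n<t (t≢n+1 ∘ sym)) t<m)
    result : (∃[ y ] y ≢ c × TriFree (λ t → paint f 0 1 y t ≡ y)) → Normal c f
    result (y , y≢c , tri) with ≤⇒∃+ {2} (≤-trans (s≤s (s≤s z≤n)) 5≤n)
    ... | l , l+2≡n = 2 , 2<m , view 2 f₂ , 1 + l , reach-view 2<m (r₁ +++ r₂) , cost , onWindow-view-2 f₂-in f₂-out
      where
      2+l≡n : 2 + l ≡ n
      2+l≡n = trans (+-comm 2 l) l+2≡n
      f₁ f₂ : ℕ → Colour
      f₁ = paint f 0 1 y
      f₂ = paint f₁ 2 l c
      r₁ : Reach f f₁ 1
      r₁ = paintWalk 0 1 y good tri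
      f₂-out : ∀ t → t < m → f₂ t ≡ c → 2 ≤ t × t < 2 + n
      f₂-out t t<m eq with paint-inv eq
      ... | inj₁ (_ , 2≤t , t<) = 2≤t , ≤-trans (subst (t <_) 2+l≡n t<) (m≤n+m n 2)
      ... | inj₂ (eq′ , _) with paint-old y≢c eq′
      ...   | ft≡c , inj₂ 1≤t with shape t t<m ft≡c
      ...     | inj₁ refl        = contradiction 1≤t λ ()
      ...     | inj₂ (inj₁ refl) = ≤-trans (s≤s (s≤s z≤n)) 5≤n , m<n⇒m<1+n ≤-refl
      ...     | inj₂ (inj₂ refl) = s≤s 0<n , ≤-refl
      f₂-in : ∀ t → 2 ≤ t → t < 2 + n → f₂ t ≡ c
      f₂-in t 2≤t t<2+n with <-cmp t n
      ... | tri< t<n _ _  = paint-in 2≤t (subst (t <_) (sym 2+l≡n) t<n)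
      ... | tri≈ _ refl _ = trans (paint-above (≤-reflexive 2+l≡n)) (trans (paint-above 0<n) fn≡c)
      ... | tri> _ _ n<t  = trans (paint-above (subst (_≤ t) (sym 2+l≡n) (<⇒≤ n<t))) (trans (paint-above (<⇒≤ 2≤t))
                              (trans (cong f (≤-antisym (m<1+n⇒m≤n t<2+n) n<t)) fn+1≡c))
      r₂ : Reach f₁ f₂ l
      r₂ = paintWalk 2 l c (walk-good good (proj₂ (proj₂ r₁))) (triFree-arc 2 f₂-out)
      three : count c f ≤ 1 + 1 + 1
      three = sum-interval₃ m 0 1 n 1 (suc n) 1 bound
        where
        bound : ∀ t → t < m → ind (f t ≟ᶜ c) ≤ interval 0 1 t + interval n 1 t + interval (suc n) 1 t
        bound t t<m with f t ≟ᶜ c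
        ... | no _ = z≤n
        ... | yes ft≡c with shape t t<m ft≡c
        ...   | inj₁ refl        = ≤-trans (interval-in {0} {1} z≤n (s≤s z≤n)) (≤-trans (m≤m+n _ (interval n 1 0)) (m≤m+n _ _))
        ...   | inj₂ (inj₁ refl) = ≤-trans (interval-in {n} {1} ≤-refl (≤-reflexive (+-comm 1 n)))
                                     (≤-trans (m≤n+m _ (interval 0 1 n)) (m≤m+n _ _))
        ...   | inj₂ (inj₂ refl) = ≤-trans (interval-in {suc n} {1} ≤-refl (≤-reflexive (+-comm 1 (suc n)))) (m≤n+m _ _)
      cost : 1 + l + count c f ≤ 2 + n
      cost = linear 3 (λ n l x → l :+ con 2 :≡ n :⇒ x :≤ con 1 :+ con 1 :+ con 1 :⇒ goal (con 1 :+ l :+ x :≤ con 2 :+ n))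
        n l (count c f) l+2≡n three

  n<m : n < m
  n<m = s≤s (m≤m+n n _)

  n+1<m : suc n < m
  n+1<m = linear 1 (λ n → con 5 :≤ n :⇒ goal (con 1 :+ n :< :m n)) n 5≤n

  at-wrap : ∀ (f : ℕ → Colour) {a b} → a + m ≡ b → a < m → f (b % m) ≡ f a
  at-wrap f {a} refl a<m = cong f (trans ([m+n]%n≡m%n a m) (m<n⇒m%n≡m a<m))

  view-at-0 : ∀ f {s} → s < m → view s f 0 ≡ f s
  view-at-0 f {s} s<m = cong f (trans (cong (_% m) (+-identityʳ s)) (m<n⇒m%n≡m s<m))

  -- The gap from n + 1 to 0 is `n`. A third class vertex at `n` or at 1 makes the class a rotated
  -- copy of 0, n, n + 1; without either, `beyond` leaves exactly the spread shape.
  normal-pair : ∀ {c f} → Good f → f 0 ≡ c → f (suc n) ≡ c → Normal c f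
  normal-pair {c} {f} good f0≡c fn+1≡c with f n ≟ᶜ c | f 1 ≟ᶜ c
  ... | yes fn≡c | _        = normal-antipodal good f0≡c fn≡c fn+1≡c
  -- Seen from n + 1, the vertices n + 1, 0, 1 occupy the positions 0, n, n + 1.
  ... | no _     | yes f1≡c = normal-view n+1<m (normal-antipodal (good-view n+1<m good)
        (trans (view-at-0 f n+1<m) fn+1≡c)
        (trans (at-wrap f (linear 1 (λ n → goal (:m n :≡ con 1 :+ n :+ n)) n) 0<m) f0≡c)
        (trans (at-wrap f (linear 1 (λ n → goal (con 1 :+ :m n :≡ con 1 :+ n :+ (con 1 :+ n))) n)
          (linear 1 (λ n → con 5 :≤ n :⇒ goal (con 1 :< :m n)) n 5≤n)) f1≡c))
  ... | no fn≢c  | no f1≢c = normal-spread good f0≡c fn+1≡c shape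
    where
    shape : ∀ t → t < m → f t ≡ c → t ≡ 0 ⊎ (2 ≤ t × t < n) ⊎ t ≡ suc n
    shape zero          _   _    = inj₁ refl
    shape (suc zero)    _   ft≡c = contradiction ft≡c f1≢c
    shape (suc (suc t)) t<m ft≡c with <-cmp (2 + t) n | 2 + t ≟ suc n
    ... | tri< t<n _ _ | _         = inj₂ (inj₁ (s≤s (s≤s z≤n) , t<n))
    ... | tri≈ _ refl _ | _        = contradiction ft≡c fn≢c
    ... | tri> _ _ _   | yes t≡n+1 = inj₂ (inj₂ t≡n+1)
    ... | tri> _ _ n<t | no t≢n+1  = contradiction ft≡c (beyond good f0≡c fn+1≡c _ (≤∧≢⇒< n<t (t≢n+1 ∘ sym)) t<m)

  -- Without a pair of gap n, the source of the (transitive) class starts a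
  -- window of n vertices that contains it.
  normal-origin : ∀ {c f} → Good f → f 0 ≡ c → Normal c f
  normal-origin {c} {f} good f0≡c with anyUpTo? (λ s → (f s ≟ᶜ c) ×-dec (view s f (suc n) ≟ᶜ c)) m
  ... | yes (s , s<m , fs≡c , paired) = normal-view s<m (normal-pair (good-view s<m good)
        (trans (view-at-0 f s<m) fs≡c) paired)
  ... | no noPair with ≤⇒∃+ {2 + n} (linear 1 (λ n → con 5 :≤ n :⇒ goal (con 2 :+ n :≤ :m n)) n 5≤n)
  -- The vertices with an arc to 0 lie at `n` and from n + 2 on, and `n` is excluded. So the window
  -- starts at the first class vertex from n + 2 on, or at 0 if there is none.
  ...   | e , e+n+2≡m = result (first (λ t → f t ≟ᶜ c) (2 + n) e)
    where
    fn≢c : f n ≢ c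
    fn≢c fn≡c = noPair (n , n<m , fn≡c , trans (at-wrap f (linear 1 (λ n → goal (:m n :≡ n :+ (con 1 :+ n))) n) 0<m) f0≡c)
    fn+1≢c : f (suc n) ≢ c
    fn+1≢c fn+1≡c = noPair (0 , 0<m , f0≡c , trans (cong f (m<n⇒m%n≡m n+1<m)) fn+1≡c)
    low : ∀ {t} → f t ≡ c → t < 2 + n → t < n
    low {t} ft≡c t<n+2 with <-cmp t n
    ... | tri< t<n _ _  = t<n
    ... | tri≈ _ refl _ = contradiction ft≡c fn≢c
    ... | tri> _ _ n<t  = contradiction (trans (cong f (≤-antisym n<t (m<1+n⇒m≤n t<n+2))) ft≡c) fn+1≢c
    m≡ : 2 + n + e ≡ m
    m≡ = trans (+-comm (2 + n) e) e+n+2≡m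
    result : (∃[ k ] 2 + n ≤ k × k < 2 + n + e × f k ≡ c × (∀ u → 2 + n ≤ u → u < k → f u ≢ c)) ⊎
             (∀ u → 2 + n ≤ u → u < 2 + n + e → f u ≢ c) → Normal c f
    result (inj₂ none) = normal-arc good arc
      where
      arc : ∀ t → t < m → f t ≡ c → t < n
      arc t t<m ft≡c with t <? 2 + n
      ... | yes t<n+2 = low ft≡c t<n+2
      ... | no t≮n+2  = contradiction ft≡c (none t (≮⇒≥ t≮n+2) (subst (t <_) (sym m≡) t<m))
    result (inj₁ (k , n+2≤k , k<b , fk≡c , minimal)) = normal-view k<m (normal-arc (good-view k<m good) arc)
      where
      k<m : k < m
      k<m = subst (k <_) m≡ k<b
      arc : ∀ t → t < m → view k f t ≡ c → t < n
      arc t t<m eq = at eq (shifted k<m t<m)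
        where
        at : ∀ {u} → f u ≡ c → Shifted k t u → t < n
        at _ (straight k+t<m) = linear 3 (λ n k t → k :+ t :< :m n :⇒ con 2 :+ n :≤ k :⇒ goal (t :< n)) n k t k+t<m n+2≤k
        at fu≡c (wrapped u u+m≡k+t) with u <? 2 + n
        ... | no u≮n+2 = contradiction fu≡c (minimal u (≮⇒≥ u≮n+2)
                (linear 4 (λ m k t u → u :+ m :≡ k :+ t :⇒ t :< m :⇒ goal (u :< k)) m k t u u+m≡k+t t<m))
        at fu≡c (wrapped zero m≡k+t) | yes _ =
          linear 3 (λ n k t → :m n :≡ k :+ t :⇒ con 2 :+ n :≤ k :⇒ goal (t :< n)) n k t m≡k+t n+2≤k
        at fu≡c (wrapped u@(suc _) u+m≡k+t) | yes u<n+2 with ≤⇒∃+ (≤-trans (<⇒≤ u<n+2) n+2≤k) | ≤⇒∃+ (<⇒≤ k<m)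
        ... | q , q+u≡k | r , r+k≡m
          with good c u q r refl (trans (+-comm u q) q+u≡k) (trans (+-comm k r) r+k≡m) (s≤s z≤n)
                 (linear 4 (λ n k q u → q :+ u :≡ k :⇒ u :< n :⇒ con 2 :+ n :≤ k :⇒ goal (con 1 :≤ q)) n k q u q+u≡k (low fu≡c u<n+2) n+2≤k)
                 k<m f0≡c fu≡c fk≡c
        ...   | inj₁ bu = contradiction bu (forward⇒¬backward (inj₁ (low fu≡c u<n+2)))
        ...   | inj₂ (inj₂ br) = contradiction br (forward⇒¬backward
                  (inj₁ (linear 3 (λ n k r → r :+ k :≡ :m n :⇒ con 2 :+ n :≤ k :⇒ goal (r :< n)) n k r r+k≡m n+2≤k)))
        ...   | inj₂ (inj₁ (inj₁ q≡n)) = contradiction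
                  (k , k<m , fk≡c , trans (at-wrap f (linear 4 (λ n k q u → q :+ u :≡ k :⇒ q :≡ n :⇒
                    goal (u :+ :m n :≡ k :+ (con 1 :+ n))) n k q u q+u≡k q≡n) (<-trans (low fu≡c u<n+2) n<m)) fu≡c) noPair
        ...   | inj₂ (inj₁ (inj₂ n+2≤q)) = linear 5 (λ n k t q u → u :+ :m n :≡ k :+ t :⇒ q :+ u :≡ k :⇒ con 2 :+ n :≤ q :⇒
                  goal (t :< n)) n k t q u u+m≡k+t q+u≡k n+2≤q

  normalise : ∀ c {f} → Good f → Normal c f
  normalise c {f} good with anyUpTo? (λ s → f s ≟ᶜ c) m
  ... | yes (s , s<m , fs≡c) = normal-view s<m (normal-origin (good-view s<m good)
        (trans (view-at-0 f s<m) fs≡c))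
  ... | no none = normal-arc good λ t t<m ft≡c → contradiction (t , t<m , ft≡c) none

-- Assembling the walk and the bound

module Diameter (n : ℕ) (5≤n : 5 ≤ n) where
  open Circle n
  open View n
  open Conversion n 5≤n
  open Route n 5≤n
  open Linking n 5≤n
  open Normalising n 5≤n

  reverse-reach : ∀ {f g b} → Good f → Reach f g b → Reach g f b
  reverse-reach good (k , k≤b , w) = k , k≤b , reverse good w

  reach-≤ : ∀ {f g a b} → a ≤ b → Reach f g a → Reach f g b
  reach-≤ a≤b (k , k≤a , w) = k , ≤-trans k≤a a≤b , w

  -- The colouring `g` is purified with `d` and `e` in exchanged roles because `link` exchanges
  -- them.
  connect : ∀ {c d e f g s} → Distinct c d e → s ≤ n → Good f → Good g → OnWindow c f → OnWindow c g →
            Reach (view s f) g (distance f (pure c d e) + 2 * n + distance g (pure c e d))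
  connect {c} {d} {e} {f} {g} {s} dist@(c≢d , c≢e , d≢e) s≤n good-f good-g (low-f , high-f) (low-g , high-g) =
    assemble (link dist (walk-good good-f w-f) s≤n)
    where
    w-f : Walk f (pure c d e) (distance f (pure c d e))
    w-f = purify dist good-f low-f (high-f n ≤-refl n<m)
    w-g : Walk g (pure c e d) (distance g (pure c e d))
    w-g = purify (c≢e , c≢d , d≢e ∘ sym) good-g low-g (high-g n ≤-refl n<m)
    s<m : s < m
    s<m = ≤-<-trans s≤n n<m
    assemble : (∃[ L ] Reach (pure c d e) L (2 * n) × view s L ≗ pure c e d) →
               Reach (view s f) g (distance f (pure c d e) + 2 * n + distance g (pure c e d))
    assemble (L , r , L≗) = reach-view s<m ((_ , ≤-refl , w-f) +++ r) +++
      reach-≗ L≗ (_ , ≤-refl , reverse good-g w-g)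

  -- Exchanging the roles of d and e replaces each purification cost x by at
  -- most n + 1 - x, so the better choice costs at most n + 1 for both ends.
  connect-windows : ∀ {c f g s} → s ≤ n → Good f → Good g → OnWindow c f → OnWindow c g →
                    Reach (view s f) g (3 * n + 1)
  connect-windows {c} {f} {g} {s} s≤n good-f good-g win-f win-g with third c c
  ... | d , d≢c , _ with third c d
  ...   | e , e≢c , e≢d = better
    where
    dist : Distinct c d e
    dist = d≢c ∘ sym , e≢c ∘ sym , e≢d ∘ sym
    dist′ : Distinct c e d
    dist′ = e≢c ∘ sym , d≢c ∘ sym , e≢d
    x x′ y y′ : ℕ
    x  = distance f (pure c d e)
    x′ = distance f (pure c e d)
    y  = distance g (pure c e d)
    y′ = distance g (pure c d e)
    better : Reach (view s f) g (3 * n + 1)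
    better with x + y ≤? suc n
    ... | yes x+y≤n+1 = reach-≤ (linear 3 (λ n x y → x :+ y :≤ con 1 :+ n :⇒ goal (x :+ 2 :* n :+ y :≤ 3 :* n :+ con 1)) n x y x+y≤n+1)
          (connect dist s≤n good-f good-g win-f win-g)
    ... | no x+y≰n+1 = reach-≤
          (linear 5 (λ n x x′ y y′ → con 1 :+ n :< x :+ y :⇒ x :+ x′ :≤ con 1 :+ n :⇒ y :+ y′ :≤ con 1 :+ n :⇒
              goal (x′ :+ 2 :* n :+ y′ :≤ 3 :* n :+ con 1)) n x x′ y y′
            (≰⇒> x+y≰n+1) (purify-cost dist win-f) (purify-cost dist′ win-g))
          (connect dist′ s≤n good-f good-g win-f win-g)

  unview : ∀ {f g s b} → s < m → Reach (view s f) (view s g) b → Reach f g b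
  unview {f} {g} {s} s<m r with shift-surjective 0 s<m 0<m
  ... | t , t<m , s+t≡0 with reach-view t<m r
  ...   | k , k≤b , w = k , k≤b , subst (Walk f g) (+-identityʳ k) (done (λ u u<m → sym (undo f u u<m)) ++ w ++ done (undo g))
    where
    undo : ∀ h → view t (view s h) ≗ h
    undo h u u<m = trans (view-view t s h u u<m) (trans (cong (λ v → view v h u) s+t≡0) (view-0 h u u<m))

  -- All pieces are read in the frame of `g`, where `t` is the origin: rotating by `s` and then by
  -- `u` is rotating by `t`. `unview` rotates the assembled walk back.
  meet : ∀ {f g f′ g′ c s t u a b} → Good f → Good g → s < m → t < m → u ≤ n → (s + u) % m ≡ t →
         Reach (view s f) f′ a → Reach (view t g) g′ b → OnWindow c f′ → OnWindow c g′ →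
         Reach f g (a + (3 * n + 1 + b))
  meet {f} {g} {s = s} {u = u} good-f good-g s<m t<m u≤n refl r@(_ , _ , w) r′@(_ , _ , w′) win win′ = unview t<m
    (reach-≗ (λ v v<m → sym (view-view u s f v v<m)) (reach-view (≤-<-trans u≤n n<m) r) +++
     connect-windows u≤n (walk-good (good-view s<m good-f) w) (walk-good (good-view t<m good-g) w′) win win′ +++
     reverse-reach (good-view t<m good-g) r′)

  count-total : ∀ f → count zero f + count (suc zero) f + count (suc (suc zero)) f ≡ m
  count-total f = trans (sym (trans (sum-+ m _ _) (cong (_+ count (suc (suc zero)) f) (sum-+ m _ _))))
                    (trans (sum-cong m λ t _ → one (f t)) (sum-one m))
    where
    one : ∀ x → ind (x ≟ᶜ zero) + ind (x ≟ᶜ suc zero) + ind (x ≟ᶜ suc (suc zero)) ≡ 1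
    one zero             = refl
    one (suc zero)       = refl
    one (suc (suc zero)) = refl

  -- If each of the three joint counts were at most k - q - 1, their sum 2k would be at most 3k - 3q
  -- - 3, so k would be at least 3q + 3.
  pigeonhole : ∀ k q (a b : Colour → ℕ) → k ≤ 2 + 3 * q →
               a zero + a (suc zero) + a (suc (suc zero)) ≡ k → b zero + b (suc zero) + b (suc (suc zero)) ≡ k →
               ∃[ c ] k ≤ a c + b c + q
  pigeonhole k q a b k≤ Σa Σb = search (k ≤? _) (k ≤? _) (k ≤? _)
    where
    x : Colour → ℕ
    x c = a c + b c
    total : 2 * k ≤ x zero + x (suc zero) + x (suc (suc zero))
    total = linear 7 (λ k a₀ a₁ a₂ b₀ b₁ b₂ → a₀ :+ a₁ :+ a₂ :≡ k :⇒ b₀ :+ b₁ :+ b₂ :≡ k :⇒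
      goal (2 :* k :≤ a₀ :+ b₀ :+ (a₁ :+ b₁) :+ (a₂ :+ b₂)))
      k (a zero) (a (suc zero)) (a (suc (suc zero))) (b zero) (b (suc zero)) (b (suc (suc zero))) Σa Σb
    search : Dec (k ≤ x zero + q) → Dec (k ≤ x (suc zero) + q) → Dec (k ≤ x (suc (suc zero)) + q) → ∃[ c ] k ≤ x c + q
    search (yes h) _ _ = zero , h
    search _ (yes h) _ = suc zero , h
    search _ _ (yes h) = suc (suc zero) , h
    search (no h₀) (no h₁) (no h₂) = ⊥-elim (linear 5
      (λ k x y z q → x :+ q :< k :⇒ y :+ q :< k :⇒ z :+ q :< k :⇒ 2 :* k :≤ x :+ y :+ z :⇒ k :≤ con 2 :+ 3 :* q :⇒ goal falsum)
      k (x zero) (x (suc zero)) (x (suc (suc zero))) q (≰⇒> h₀) (≰⇒> h₁) (≰⇒> h₂) total k≤)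

  frequent-colour : ∀ f g → ∃[ c ] m ≤ count c f + count c g + (2 * n + 1) / 3
  frequent-colour f g = pigeonhole m q (λ c → count c f) (λ c → count c g) m≤ (count-total f) (count-total g)
    where
    open ≤-Reasoning
    q : ℕ
    q = (2 * n + 1) / 3
    m≤ : m ≤ 2 + 3 * q
    m≤ = begin
      m                              ≡⟨ +-comm 1 (2 * n) ⟩
      2 * n + 1                      ≡⟨ m≡m%n+[m/n]*n (2 * n + 1) 3 ⟩
      (2 * n + 1) % 3 + q * 3        ≤⟨ +-monoˡ-≤ (q * 3) (m<1+n⇒m≤n (m%n<n (2 * n + 1) 3)) ⟩
      2 + q * 3                      ≡⟨ cong (2 +_) (*-comm q 3) ⟩
      2 + 3 * q                      ∎

  -- Adding the first two bounds gives a + b ≤ 2n + 4 - (x + y), and the third turns this into a + b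
  -- ≤ 3 + q.
  cost : ∀ a b x y q → a + x ≤ 2 + n → b + y ≤ 2 + n → m ≤ x + y + q → a + (3 * n + 1 + b) ≤ 3 * n + 4 + q
  cost = linear 6 (λ n a b x y q → a :+ x :≤ con 2 :+ n :⇒ b :+ y :≤ con 2 :+ n :⇒ :m n :≤ x :+ y :+ q :⇒
    goal (a :+ (3 :* n :+ con 1 :+ b) :≤ 3 :* n :+ con 4 :+ q)) n

  offset-back : ∀ {s t u v} → s < m → (s + u) % m ≡ t → v + u ≡ m → (t + v) % m ≡ s
  offset-back {s} {t} {u} {v} s<m s+u≡t v+u≡m = begin
    (t + v) % m               ≡⟨ cong (λ t → (t + v) % m) s+u≡t ⟨
    ((s + u) % m + v) % m     ≡⟨ cong (_% m) (+-comm ((s + u) % m) v) ⟩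
    (v + (s + u) % m) % m     ≡⟨ %-absorb v (s + u) ⟩
    (v + (s + u)) % m         ≡⟨ cong (_% m) (linear 4 (λ m s u v → v :+ u :≡ m :⇒ goal (v :+ (s :+ u) :≡ s :+ m)) m s u v v+u≡m) ⟩
    (s + m) % m               ≡⟨ [m+n]%n≡m%n s m ⟩
    s % m                     ≡⟨ m<n⇒m%n≡m s<m ⟩
    s                         ∎
    where open ≡-Reasoning

  reach-normal : ∀ {f g} c q → Good f → Good g → m ≤ count c f + count c g + q → Normal c f → Normal c g →
                 Reach f g (3 * n + 4 + q)
  reach-normal {f} {g} c q good-f good-g often (s , s<m , f′ , a , r , a≤ , win) (t , t<m , g′ , b , r′ , b≤ , win′) =
    turn (shift-surjective t s<m t<m)
    where
    often′ : m ≤ count c g + count c f + q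
    often′ = subst (λ k → m ≤ k + q) (+-comm (count c f) (count c g)) often
    turn : (∃[ u ] u < m × (s + u) % m ≡ t) → Reach f g (3 * n + 4 + q)
    turn (u , u<m , s+u≡t) with u ≤? n
    ... | yes u≤n = reach-≤ (cost a b (count c f) (count c g) q a≤ b≤ often)
                      (meet good-f good-g s<m t<m u≤n s+u≡t r r′ win win′)
    -- From `t` back to `s` the rotation is v = m - u ≤ n, so the walk is built from `g` to `f` and
    -- reversed.
    ... | no u≰n with ≤⇒∃+ (<⇒≤ u<m)
    ...   | v , v+u≡m = reverse-reach good-g (reach-≤ (cost b a (count c g) (count c f) q b≤ a≤ often′)
                          (meet good-g good-f t<m s<m v≤n (offset-back s<m s+u≡t v+u≡m) r′ r win′ win))
      where
      v≤n : v ≤ n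
      v≤n = linear 3 (λ n u v → v :+ u :≡ :m n :⇒ n :< u :⇒ goal (v :≤ n)) n u v v+u≡m (≰⇒> u≰n)

  reach : ∀ {f g} → Good f → Good g → Reach f g (3 * n + 4 + (2 * n + 1) / 3)
  reach {f} {g} good-f good-g = choose (frequent-colour f g)
    where
    choose : (∃[ c ] m ≤ count c f + count c g + (2 * n + 1) / 3) → Reach f g (3 * n + 4 + (2 * n + 1) / 3)
    choose (c , often) = reach-normal c ((2 * n + 1) / 3) good-f good-g often (normalise c good-f) (normalise c good-g)

  diameter : DicolGraphDiamAtMost (Ctour n) 3 (3 * n + 4 + (2 * n + 1) / 3)
  diameter α β = realise (reach (extend-good α) (extend-good β))
    where
    realise : ∀ {b} → Reach (extend α) (extend β) b → ∃[ k ] k ≤ b × WalkOfLength α β k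
    realise (k , k≤b , w) = k , k≤b , toWalk α β w λ _ _ → refl

theorem4 : (n : ℕ) → 5 ≤ n →
    DicolGraphConnected (Ctour n) 3 ×
    DicolGraphDiamAtMost (Ctour n) 3 (3 * n + 4 + (2 * n + 1) / 3)
theorem4 n 5≤n = (λ α β → connected (diameter α β)) , diameter
  where
  open Diameter n 5≤n
  connected : ∀ {α β b} → ∃[ k ] k ≤ b × WalkOfLength {Ctour n} {3} α β k → ∃[ k ] WalkOfLength α β k
  connected (k , _ , w) = k , w
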